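{- Let $S$ be the set of all $2$-element subsets of $\{0,1,2,3,4,5\}$ (so $|S|=15$; write $ab$ for $\{a,b\}$) and $T=\{0,1,2,3,4,5\}$. Let $E_1=\{(e,v)\in S\times T: v\in e\}$ be the incidence graph of $K_6$ (so $|E_1|=30$), and let $$\begin{aligned} E_2=\{&(01,2;35,4),\ (01,3;45,2),\ (02,1;34,5),\ (02,3;14,5),\\ &(04,3;15,2),\ (04,5;12,3),\ (05,3;24,1),\ (05,4;23,1),\\ &(13,0;24,5),\ (14,2;35,0),\ (15,4;23,0),\ (25,1;34,0),\\ &(03,5;25,4),\ (13,2;03,4)\}. \end{aligned}$$ Then the augmented bipartite graph $G=(S,T,E_1\cup E_2)$ is weak admissible. Consequently, $$z_{wL}(15,6)\ge |E_1|+|E_2|=30+14=44,$$ and hence $\mathrm{BSR}(15,6)\ge 44$.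
   Context: Notation: an $m\times n$ biquadratic form is a real polynomial $P(\mathbf{x},\mathbf{y})=\sum_{i,k=1}^m\sum_{j,l=1}^n a_{ijkl}x_ix_ky_jy_l$ (with $a_{ijkl}=a_{kjil}=a_{klij}$). It is SOS if $P=\sum_{p=1}^r f_p^2$ with each $f_p$ a real bilinear form in $(\mathbf{x},\mathbf{y})$; the minimum such $r$ is its SOS rank $\mathrm{SOS}(P)$. $\mathrm{BSR}(m,n)$ is the maximum SOS rank among all $m\times n$ SOS biquadratic forms. $z(m,n)$ (the Zarankiewicz number) is the maximum number of edges of an $m\times n$ bipartite graph with no $C_4$. Augmented bipartite graphs $G=(S,T,E_1\cup E_2)$, with $|S|=m$, $|T|=n$ (by default $S=\{1,\dots,m\}$, $T=\{1,\dots,n\}$; other index sets are identified with these by relabelling). A cell is a pair $(i,j)\in S\times T$ ($i$ is its row, $j$ its column). A 1-edge is a cell; $E_1$ is a set of 1-edges, viewed as a bipartite graph $G_1$ on $S,T$. A 2-edge is an unordered pair of distinct cells, written $(i,j;k,l)$; the cells $(i,j)$ and $(k,l)$ are its two halves. It is nondegenerate if $i\ne k$ and $j\ne l$, row-degenerate if $i=k$ and $j\neq l$, column-degenerate if $i\ne k$ and $j=l$. $E_2$ is a set of 2-edges. A cell is occupied if it is in $E_1$ or is a half of some 2-edge in $E_2$; otherwise it is unoccupied. The opposite cells of a nondegenerate 2-edge $(i,j;k,l)$ are $(i,l)$ and $(k,j)$. Two nondegenerate 2-edges of the form $(i,j;k,l)$ and $(i,l;k,j)$ are called complementary. The dependency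 graph $\mathcal{D}$ is the directed graph whose vertices are the nondegenerate 2-edges in $E_2$, with an arc $e\to e'$ ($e\ne e'$) if both opposite cells of $e$ are occupied and one half of $e'$ is an opposite cell of $e$. An edge's row (column) set is the set of rows (columns) of its cell (1-edge) or of its halves (2-edge). Two edges are vertex-disjoint if their row sets are disjoint and their column sets are disjoint (here rows are elements of $S$). The opposite cells of a vertex-disjoint pair $e,f$ are the cells formed by a row of one of the two edges and a column of the other. For a 1-edge $(i,j)$ and a 2-edge $(k,l;p,q)$ they are $(i,l),(i,q),(k,j),(p,j)$. $G$ is weak admissible if it satisfies: (S) No 2-edge shares a cell with any 1-edge or with any other 2-edge. (W1) $G_1$ contains no $C_4$. (W2) $\mathcal{D}$ contains no directed cycle other than 2-cycles formed by a pair of complementary 2-edges (which are allowed). (W2') There is no nondegenerate 2-edge in $E_2$ whose two opposite cells are both 1-edges. (W3) For every vertex-disjoint pair of edges of $G$ at least one of which is a 2-edge, at least one of the opposite cells of the pair is unoccupied. $z_{wL}(m,n)$ is the maximum of $|E_1|+|E_2|$ over all weak admissible $G$ with $|E_1|=z(m,n)$. -}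

module Defs where

open import Data.Fin as Fin using (Fin; #_)
import Data.Fin.Properties as Fin
open import Data.Fin.Subset as Subset using (Subset; ⁅_⁆; _∪_; ∣_∣)
import Data.Fin.Subset.Properties as Subset
open import Data.List using (List; []; _∷_; _∷ʳ_; length; filter; cartesianProduct; allFin)
open import Data.List.Membership.Propositional using (_∈_; _∉_)
open import Data.List.Relation.Unary.AllPairs using (AllPairs; allPairs?)
open import Data.List.Relation.Unary.Any using (Any)
open import Data.List.Relation.Unary.Linked using (Linked)
open import Data.List.Relation.Unary.Unique.Propositional using (Unique)
import Data.List.Relation.Unary.Unique.Propositional.Properties as Unique
open import Data.Nat as ℕ using (ℕ; _≤_; _⊔_)
import Data.Nat.Properties as ℕ
open import Data.Product using (Σ; ∃-syntax; _×_; _,_; proj₁; proj₂)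
open import Data.Product.Properties using (≡-dec)
open import Data.Rational as ℚ using (ℚ; 0ℚ; 1ℚ; ½)
import Data.Rational.Properties as ℚ
open import Data.Rational.Solver using (module +-*-Solver)
open import Data.Sum using (_⊎_; inj₁; inj₂)
import Data.Vec as Vec
import Data.Vec.Properties as Vec
import Data.Bool.Properties as Bool
open import Data.Vec.Functional using (foldr)
open import Relation.Binary using (DecidableEquality; Decidable)
open import Relation.Binary.PropositionalEquality
  using (_≡_; _≢_; refl; sym; cong; cong₂; subst)
open import Relation.Nullary using (¬_; yes; no)
open import Relation.Nullary.Decidable
  using (False; toWitnessFalse; from-yes; from-no; decidable-stable;
         ¬?; _×-dec_; _⊎-dec_; _→-dec_)
open import Relation.Unary using (Pred)
open import Level using (0ℓ)

record IsMaximum (P : Pred ℕ 0ℓ) (k : ℕ) : Set where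
  field
    attained : P k
    bound    : ∀ {n} → P n → n ≤ k

record IsMinimum (P : Pred ℕ 0ℓ) (k : ℕ) : Set where
  field
    attained : P k
    bound    : ∀ {n} → P n → k ≤ n

-- "max P ≥ k".  The maximum of a bounded inhabited set of naturals need not
-- be constructively computable, so the inequality for the maximum comes with
-- an element of P witnessing it; a vacuous reading is thereby excluded.

record MaxAtLeast (P : Pred ℕ 0ℓ) (k : ℕ) : Set where
  field
    maximum≥ : ∀ {M} → IsMaximum P M → k ≤ M
    witness  : ∃[ n ] P n × k ≤ n

-- ℝ consists of Cauchy sequences of rationals, with _≈_ as its equality.

IsCauchy : (ℕ → ℚ) → Set
IsCauchy s = ∀ ε → 0ℚ ℚ.< ε →
  ∃[ N ] (∀ m n → N ≤ m → N ≤ n → ℚ.∣ s m ℚ.- s n ∣ ℚ.< ε)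

record ℝ : Set where
  field
    seq    : ℕ → ℚ
    cauchy : IsCauchy seq

open ℝ

infix 4 _≈_

_≈_ : ℝ → ℝ → Set
x ≈ y = ∀ ε → 0ℚ ℚ.< ε →
  ∃[ N ] (∀ n → N ≤ n → ℚ.∣ seq x n ℚ.- seq y n ∣ ℚ.< ε)

private

  half>0 : ∀ ε → 0ℚ ℚ.< ε → 0ℚ ℚ.< ½ ℚ.* ε
  half>0 ε ε>0 = ℚ.positive⁻¹ (½ ℚ.* ε) {{ℚ.pos*pos⇒pos ½ ε {{ℚ.positive ε>0}}}}

  halves : ∀ ε → ½ ℚ.* ε ℚ.+ ½ ℚ.* ε ≡ ε
  halves = solve 1 (λ ε → con ½ :* ε :+ con ½ :* ε := ε) refl
    where open +-*-Solver

  const-cauchy : ∀ q → IsCauchy (λ _ → q)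
  const-cauchy q ε ε>0 =
    0 , λ _ _ _ _ → subst (λ d → ℚ.∣ d ∣ ℚ.< ε) (sym (ℚ.+-inverseʳ q)) ε>0

  +-cauchy : ∀ {s t} → IsCauchy s → IsCauchy t → IsCauchy (λ n → s n ℚ.+ t n)
  +-cauchy {s} {t} cs ct ε ε>0
    with cs (½ ℚ.* ε) (half>0 ε ε>0) | ct (½ ℚ.* ε) (half>0 ε ε>0)
  ... | M , s-close | N , t-close = M ⊔ N , λ m n ≤m ≤n →
    let open ℚ.≤-Reasoning in begin-strict
      ℚ.∣ (s m ℚ.+ t m) ℚ.- (s n ℚ.+ t n) ∣
        ≡⟨ cong ℚ.∣_∣ (rearrange (s m) (t m) (s n) (t n)) ⟩
      ℚ.∣ (s m ℚ.- s n) ℚ.+ (t m ℚ.- t n) ∣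
        ≤⟨ ℚ.∣p+q∣≤∣p∣+∣q∣ (s m ℚ.- s n) (t m ℚ.- t n) ⟩
      ℚ.∣ s m ℚ.- s n ∣ ℚ.+ ℚ.∣ t m ℚ.- t n ∣
        <⟨ ℚ.+-mono-< (s-close m n (ℕ.m⊔n≤o⇒m≤o M N ≤m) (ℕ.m⊔n≤o⇒m≤o M N ≤n))
                      (t-close m n (ℕ.m⊔n≤o⇒n≤o M N ≤m) (ℕ.m⊔n≤o⇒n≤o M N ≤n)) ⟩
      ½ ℚ.* ε ℚ.+ ½ ℚ.* ε
        ≡⟨ halves ε ⟩
      ε ∎
    where
    open +-*-Solver
    rearrange : ∀ a b c d →
      (a ℚ.+ b) ℚ.- (c ℚ.+ d) ≡ (a ℚ.- c) ℚ.+ (b ℚ.- d)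
    rearrange = solve 4 (λ a b c d →
      (a :+ b) :- (c :+ d) := (a :- c) :+ (b :- d)) refl

  eventually-bounded : ∀ {s} → IsCauchy s →
    ∃[ B ] 0ℚ ℚ.< B × ∃[ N ] (∀ n → N ≤ n → ℚ.∣ s n ∣ ℚ.≤ B)
  eventually-bounded {s} cs with cs 1ℚ (ℚ.positive⁻¹ 1ℚ)
  ... | N , close = 1ℚ ℚ.+ ℚ.∣ s N ∣
                  , ℚ.+-mono-<-≤ (ℚ.positive⁻¹ 1ℚ) (ℚ.0≤∣p∣ (s N))
                  , N , λ n N≤n →
    let open ℚ.≤-Reasoning in begin
      ℚ.∣ s n ∣                          ≡⟨ cong ℚ.∣_∣ (split (s n) (s N)) ⟩
      ℚ.∣ (s n ℚ.- s N) ℚ.+ s N ∣        ≤⟨ ℚ.∣p+q∣≤∣p∣+∣q∣ (s n ℚ.- s N) (s N) ⟩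
      ℚ.∣ s n ℚ.- s N ∣ ℚ.+ ℚ.∣ s N ∣    ≤⟨ ℚ.+-monoˡ-≤ ℚ.∣ s N ∣
                                             (ℚ.<⇒≤ (close n N N≤n ℕ.≤-refl)) ⟩
      1ℚ ℚ.+ ℚ.∣ s N ∣                   ∎
    where
    open +-*-Solver
    split : ∀ a b → a ≡ (a ℚ.- b) ℚ.+ b
    split = solve 2 (λ a b → a := (a :- b) :+ b) refl

  quotient : ∀ B ε → 0ℚ ℚ.< B → 0ℚ ℚ.< ε → ∃[ δ ] 0ℚ ℚ.< δ × B ℚ.* δ ≡ ε
  quotient B ε B>0 ε>0 = B⁻¹ ℚ.* ε , δ>0 , eq
    where
    instance
      B-positive = ℚ.positive B>0
      B-nonZero  = ℚ.pos⇒nonZero B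
      ε-positive = ℚ.positive ε>0
    B⁻¹ = ℚ.1/ B
    instance
      B⁻¹-positive = ℚ.1/pos⇒pos B
    δ>0 : 0ℚ ℚ.< B⁻¹ ℚ.* ε
    δ>0 = ℚ.positive⁻¹ (B⁻¹ ℚ.* ε) {{ℚ.pos*pos⇒pos B⁻¹ ε}}
    open ℚ.≤-Reasoning
    eq : B ℚ.* (B⁻¹ ℚ.* ε) ≡ ε
    eq = begin-equality
      B ℚ.* (B⁻¹ ℚ.* ε)    ≡⟨ ℚ.*-assoc B B⁻¹ ε ⟨
      (B ℚ.* B⁻¹) ℚ.* ε    ≡⟨ cong (ℚ._* ε) (ℚ.*-inverseʳ B) ⟩
      1ℚ ℚ.* ε             ≡⟨ ℚ.*-identityˡ ε ⟩
      ε                    ∎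

  ∣*∣-bound : ∀ p q {B δ} → 0ℚ ℚ.< B → ℚ.∣ p ∣ ℚ.≤ B → ℚ.∣ q ∣ ℚ.< δ →
              ℚ.∣ p ℚ.* q ∣ ℚ.< B ℚ.* δ
  ∣*∣-bound p q {B} {δ} B>0 ∣p∣≤B ∣q∣<δ = begin-strict
    ℚ.∣ p ℚ.* q ∣          ≡⟨ ℚ.∣p*q∣≡∣p∣*∣q∣ p q ⟩
    ℚ.∣ p ∣ ℚ.* ℚ.∣ q ∣    ≤⟨ ℚ.*-monoʳ-≤-nonNeg ℚ.∣ q ∣ {{ℚ.∣-∣-nonNeg q}} ∣p∣≤B ⟩
    B ℚ.* ℚ.∣ q ∣          <⟨ ℚ.*-monoʳ-<-pos B {{ℚ.positive B>0}} ∣q∣<δ ⟩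
    B ℚ.* δ                ∎
    where open ℚ.≤-Reasoning

  product-close : ∀ p q p′ q′ {A B α β ε} → 0ℚ ℚ.< A → 0ℚ ℚ.< B →
    A ℚ.* α ≡ ½ ℚ.* ε → B ℚ.* β ≡ ½ ℚ.* ε →
    ℚ.∣ p ∣ ℚ.≤ A → ℚ.∣ q′ ∣ ℚ.≤ B →
    ℚ.∣ q ℚ.- q′ ∣ ℚ.< α → ℚ.∣ p ℚ.- p′ ∣ ℚ.< β →
    ℚ.∣ p ℚ.* q ℚ.- p′ ℚ.* q′ ∣ ℚ.< ε
  product-close p q p′ q′ {A} {B} {α} {β} {ε} A>0 B>0 Aα≡ Bβ≡ p≤A q′≤B q-close p-close =
    begin-strict
      ℚ.∣ p ℚ.* q ℚ.- p′ ℚ.* q′ ∣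
        ≡⟨ cong ℚ.∣_∣ (rearrange p q p′ q′) ⟩
      ℚ.∣ p ℚ.* (q ℚ.- q′) ℚ.+ q′ ℚ.* (p ℚ.- p′) ∣
        ≤⟨ ℚ.∣p+q∣≤∣p∣+∣q∣ (p ℚ.* (q ℚ.- q′)) (q′ ℚ.* (p ℚ.- p′)) ⟩
      ℚ.∣ p ℚ.* (q ℚ.- q′) ∣ ℚ.+ ℚ.∣ q′ ℚ.* (p ℚ.- p′) ∣
        <⟨ ℚ.+-mono-< (∣*∣-bound p (q ℚ.- q′) A>0 p≤A q-close)
                      (∣*∣-bound q′ (p ℚ.- p′) B>0 q′≤B p-close) ⟩
      A ℚ.* α ℚ.+ B ℚ.* β
        ≡⟨ cong₂ ℚ._+_ Aα≡ Bβ≡ ⟩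
      ½ ℚ.* ε ℚ.+ ½ ℚ.* ε
        ≡⟨ halves ε ⟩
      ε ∎
    where
    open ℚ.≤-Reasoning
    open +-*-Solver
    rearrange : ∀ a b c d →
      a ℚ.* b ℚ.- c ℚ.* d ≡ a ℚ.* (b ℚ.- d) ℚ.+ d ℚ.* (a ℚ.- c)
    rearrange = solve 4 (λ a b c d →
      a :* b :- c :* d := a :* (b :- d) :+ d :* (a :- c)) refl

  *-cauchy : ∀ {s t} → IsCauchy s → IsCauchy t → IsCauchy (λ n → s n ℚ.* t n)
  *-cauchy {s} {t} cs ct ε ε>0 =
    let A , A>0 , N₁ , s-bound = eventually-bounded {s} cs
        B , B>0 , N₂ , t-bound = eventually-bounded {t} ct
        α , α>0 , Aα≡ = quotient A (½ ℚ.* ε) A>0 (half>0 ε ε>0)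
        β , β>0 , Bβ≡ = quotient B (½ ℚ.* ε) B>0 (half>0 ε ε>0)
        N₃ , t-close = ct α α>0
        N₄ , s-close = cs β β>0
    in (N₁ ⊔ N₂) ⊔ (N₃ ⊔ N₄) , λ m n ≤m ≤n →
      product-close (s m) (t m) (s n) (t n) A>0 B>0 Aα≡ Bβ≡
        (s-bound m (≥₁ N₁ N₂ N₃ N₄ ≤m))
        (t-bound n (≥₂ N₁ N₂ N₃ N₄ ≤n))
        (t-close m n (≥₃ N₁ N₂ N₃ N₄ ≤m) (≥₃ N₁ N₂ N₃ N₄ ≤n))
        (s-close m n (≥₄ N₁ N₂ N₃ N₄ ≤m) (≥₄ N₁ N₂ N₃ N₄ ≤n))
    where
    module _ (a b c d : ℕ) {k} (≤k : (a ⊔ b) ⊔ (c ⊔ d) ≤ k) where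
      ≥₁ = ℕ.m⊔n≤o⇒m≤o a b (ℕ.m⊔n≤o⇒m≤o (a ⊔ b) (c ⊔ d) ≤k)
      ≥₂ = ℕ.m⊔n≤o⇒n≤o a b (ℕ.m⊔n≤o⇒m≤o (a ⊔ b) (c ⊔ d) ≤k)
      ≥₃ = ℕ.m⊔n≤o⇒m≤o c d (ℕ.m⊔n≤o⇒n≤o (a ⊔ b) (c ⊔ d) ≤k)
      ≥₄ = ℕ.m⊔n≤o⇒n≤o c d (ℕ.m⊔n≤o⇒n≤o (a ⊔ b) (c ⊔ d) ≤k)

infixl 6 _+ᴿ_
infixl 7 _*ᴿ_

fromℚ : ℚ → ℝ
fromℚ q = record { seq = λ _ → q ; cauchy = const-cauchy q }

_+ᴿ_ : ℝ → ℝ → ℝ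
x +ᴿ y = record
  { seq    = λ n → seq x n ℚ.+ seq y n
  ; cauchy = +-cauchy {seq x} {seq y} (cauchy x) (cauchy y)
  }

_*ᴿ_ : ℝ → ℝ → ℝ
x *ᴿ y = record
  { seq    = λ n → seq x n ℚ.* seq y n
  ; cauchy = *-cauchy {seq x} {seq y} (cauchy x) (cauchy y)
  }

0ℝ : ℝ
0ℝ = fromℚ 0ℚ

∑ : ∀ {n} → (Fin n → ℝ) → ℝ
∑ = foldr _+ᴿ_ 0ℝ

record BiquadraticForm (m n : ℕ) : Set where
  field
    coeff : Fin m → Fin n → Fin m → Fin n → ℝ
    symˡ  : ∀ i j k l → coeff i j k l ≈ coeff k j i l
    symᵇ  : ∀ i j k l → coeff i j k l ≈ coeff k l i j

  ⟦_⟧ : (Fin m → ℝ) → (Fin n → ℝ) → ℝ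
  ⟦_⟧ x y = ∑ λ i → ∑ λ k → ∑ λ j → ∑ λ l →
    coeff i j k l *ᴿ x i *ᴿ x k *ᴿ y j *ᴿ y l

BilinearForm : ℕ → ℕ → Set
BilinearForm m n = Fin m → Fin n → ℝ

evalBilinear : ∀ {m n} → BilinearForm m n → (Fin m → ℝ) → (Fin n → ℝ) → ℝ
evalBilinear b x y = ∑ λ i → ∑ λ j → b i j *ᴿ x i *ᴿ y j

-- P = Σ_{p<r} f_p², as polynomial functions; over ℝ this is the same as
-- equality of polynomials.

IsSumOfSquares : ∀ {m n} → BiquadraticForm m n → Pred ℕ 0ℓ
IsSumOfSquares {m} {n} P r = Σ (Fin r → BilinearForm m n) λ f →
  ∀ x y → ⟦ x ⟧ y ≈ ∑ (λ p → evalBilinear (f p) x y *ᴿ evalBilinear (f p) x y)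
  where open BiquadraticForm P

IsSOS : ∀ {m n} → BiquadraticForm m n → Set
IsSOS P = ∃[ r ] IsSumOfSquares P r

IsSOSRank : ∀ {m n} → BiquadraticForm m n → ℕ → Set
IsSOSRank P = IsMinimum (IsSumOfSquares P)

-- The set of which BSR(m,n) is the maximum.

SOSRanks : ℕ → ℕ → Pred ℕ 0ℓ
SOSRanks m n r = Σ (BiquadraticForm m n) λ P → IsSOS P × IsSOSRank P r

BSR[_,_]≥_ : ℕ → ℕ → ℕ → Set
BSR[ m , n ]≥ k = MaxAtLeast (SOSRanks m n) k

Cell : ℕ → ℕ → Set
Cell m n = Fin m × Fin n

_≟ᶜ_ : ∀ {m n} → DecidableEquality (Cell m n)
_≟ᶜ_ = ≡-dec Fin._≟_ Fin._≟_

record BipartiteGraph (m n : ℕ) : Set where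
  field
    edges  : List (Cell m n)
    unique : Unique edges

  ∣edges∣ : ℕ
  ∣edges∣ = length edges

C₄-free : ∀ {m n} → BipartiteGraph m n → Set
C₄-free G = ∀ {i k j l} → i ≢ k → j ≢ l →
  ¬ ((i , j) ∈ edges × (i , l) ∈ edges × (k , j) ∈ edges × (k , l) ∈ edges)
  where open BipartiteGraph G

C₄-freeSizes : ℕ → ℕ → Pred ℕ 0ℓ
C₄-freeSizes m n e =
  Σ (BipartiteGraph m n) λ G → C₄-free G × BipartiteGraph.∣edges∣ G ≡ e

IsZarankiewicz : ℕ → ℕ → ℕ → Set
IsZarankiewicz m n = IsMaximum (C₄-freeSizes m n)

-- A 2-edge is an unordered pair of cells: the order of the halves is
-- disregarded by _≃_, which is the equality used throughout.

record TwoEdge (m n : ℕ) : Set where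
  constructor mk2
  field
    half₁ half₂ : Cell m n
    .distinct   : half₁ ≢ half₂

⟨_,_⨾_,_⟩ : ∀ {m n} (i : Fin m) (j : Fin n) (k : Fin m) (l : Fin n)
            {_ : False ((i , j) ≟ᶜ (k , l))} → TwoEdge m n
⟨ i , j ⨾ k , l ⟩ {≢} = mk2 (i , j) (k , l) (toWitnessFalse ≢)

module _ {m n : ℕ} where

  open TwoEdge

  infix 4 _≃_ _≄_ _≃?_ _isHalfOf_

  _≃_ _≄_ : TwoEdge m n → TwoEdge m n → Set
  e ≃ f = (half₁ e ≡ half₁ f × half₂ e ≡ half₂ f)
        ⊎ (half₁ e ≡ half₂ f × half₂ e ≡ half₁ f)
  e ≄ f = ¬ (e ≃ f)

  _≃?_ : Decidable _≃_
  e ≃? f = ((half₁ e ≟ᶜ half₁ f) ×-dec (half₂ e ≟ᶜ half₂ f))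
     ⊎-dec ((half₁ e ≟ᶜ half₂ f) ×-dec (half₂ e ≟ᶜ half₁ f))

  _isHalfOf_ : Cell m n → TwoEdge m n → Set
  c isHalfOf e = c ≡ half₁ e ⊎ c ≡ half₂ e

  Nondegenerate : TwoEdge m n → Set
  Nondegenerate e = proj₁ (half₁ e) ≢ proj₁ (half₂ e)
                  × proj₂ (half₁ e) ≢ proj₂ (half₂ e)

  opposite₁ opposite₂ : TwoEdge m n → Cell m n
  opposite₁ e = proj₁ (half₁ e) , proj₂ (half₂ e)
  opposite₂ e = proj₁ (half₂ e) , proj₂ (half₁ e)

  Complementary : TwoEdge m n → TwoEdge m n → Set
  Complementary e f = Nondegenerate e × Nondegenerate f ×
    ( (half₁ f ≡ opposite₁ e × half₂ f ≡ opposite₂ e)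
    ⊎ (half₁ f ≡ opposite₂ e × half₂ f ≡ opposite₁ e) )

record AugmentedGraph (m n : ℕ) : Set where
  field
    G₁        : BipartiteGraph m n
    E₂        : List (TwoEdge m n)
    E₂-unique : AllPairs _≄_ E₂

  open BipartiteGraph G₁ public using () renaming (edges to E₁; ∣edges∣ to ∣E₁∣)

  ∣E₂∣ : ℕ
  ∣E₂∣ = length E₂

  Occupied Unoccupied : Cell m n → Set
  Occupied c   = c ∈ E₁ ⊎ Any (c isHalfOf_) E₂
  Unoccupied c = ¬ Occupied c

  -- Arcs of the dependency graph; its vertices are the nondegenerate
  -- members of E₂.

  record Arc (e e′ : TwoEdge m n) : Set where
    field
      source        : e ∈ E₂ × Nondegenerate e
      target        : e′ ∈ E₂ × Nondegenerate e′
      e≄e′          : e ≄ e′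
      opp₁-occupied : Occupied (opposite₁ e)
      opp₂-occupied : Occupied (opposite₂ e)
      dependent     : opposite₁ e isHalfOf e′ ⊎ opposite₂ e isHalfOf e′

  -- e₀ ∷ es lists the (pairwise distinct) vertices of a directed cycle
  -- e₀ → e₁ → … → eₖ → e₀.

  DirectedCycle : TwoEdge m n → List (TwoEdge m n) → Set
  DirectedCycle e₀ es = AllPairs _≄_ (e₀ ∷ es) × Linked Arc ((e₀ ∷ es) ∷ʳ e₀)

  data Edge : Set where
    one : (c : Cell m n) → c ∈ E₁ → Edge
    two : (e : TwoEdge m n) → e ∈ E₂ → Edge

  data Is2Edge : Edge → Set where
    is2 : ∀ {e e∈} → Is2Edge (two e e∈)

  _cellOf_ : Cell m n → Edge → Set
  c cellOf one d _ = c ≡ d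
  c cellOf two e _ = c isHalfOf e

  _rowOf_ : Fin m → Edge → Set
  i rowOf a = ∃[ j ] (i , j) cellOf a

  _columnOf_ : Fin n → Edge → Set
  j columnOf a = ∃[ i ] (i , j) cellOf a

  VertexDisjoint : Edge → Edge → Set
  VertexDisjoint a b = (∀ i → ¬ (i rowOf a × i rowOf b))
                     × (∀ j → ¬ (j columnOf a × j columnOf b))

  OppositeCell : Edge → Edge → Cell m n → Set
  OppositeCell a b (i , j) = (i rowOf a × j columnOf b)
                           ⊎ (i rowOf b × j columnOf a)

record WeakAdmissible {m n : ℕ} (G : AugmentedGraph m n) : Set where
  open AugmentedGraph G
  field
    S₁  : ∀ {c e} → e ∈ E₂ → c isHalfOf e → c ∉ E₁
    S₂  : ∀ {c e f} → e ∈ E₂ → f ∈ E₂ → e ≄ f → c isHalfOf e → ¬ (c isHalfOf f)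
    W1  : C₄-free G₁
    W2  : ∀ {e es} → DirectedCycle e es → ∃[ f ] es ≡ f ∷ [] × Complementary e f
    W2′ : ∀ {e} → e ∈ E₂ → Nondegenerate e →
          ¬ (opposite₁ e ∈ E₁ × opposite₂ e ∈ E₁)
    W3  : ∀ a b → Is2Edge a ⊎ Is2Edge b → VertexDisjoint a b →
          ∃[ c ] OppositeCell a b c × Unoccupied c

-- The set of which z_{wL}(m,n) is the maximum.

WeakAdmissibleSizes : ℕ → ℕ → Pred ℕ 0ℓ
WeakAdmissibleSizes m n k = Σ (AugmentedGraph m n) λ G →
  let open AugmentedGraph G in
  WeakAdmissible G × IsZarankiewicz m n ∣E₁∣ × ∣E₁∣ ℕ.+ ∣E₂∣ ≡ k

z-wL[_,_]≥_ : ℕ → ℕ → ℕ → Set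
z-wL[ m , n ]≥ k = MaxAtLeast (WeakAdmissibleSizes m n) k

-- The 2-element subsets of {0,…,5}, relabelled lexicographically by Fin 15.

endpoints : Vec.Vec (Fin 6 × Fin 6) 15
endpoints =
  (# 0 , # 1) Vec.∷ (# 0 , # 2) Vec.∷ (# 0 , # 3) Vec.∷ (# 0 , # 4) Vec.∷
  (# 0 , # 5) Vec.∷ (# 1 , # 2) Vec.∷ (# 1 , # 3) Vec.∷ (# 1 , # 4) Vec.∷
  (# 1 , # 5) Vec.∷ (# 2 , # 3) Vec.∷ (# 2 , # 4) Vec.∷ (# 2 , # 5) Vec.∷
  (# 3 , # 4) Vec.∷ (# 3 , # 5) Vec.∷ (# 4 , # 5) Vec.∷ Vec.[]

pair : Fin 15 → Subset 6
pair e = let (a , b) = Vec.lookup endpoints e in ⁅ a ⁆ ∪ ⁅ b ⁆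

private
  _≟ˢ_ : DecidableEquality (Subset 6)
  _≟ˢ_ = Vec.≡-dec Bool._≟_

pair-size : ∀ e → ∣ pair e ∣ ≡ 2
pair-size = from-yes (Fin.all? λ e → ∣ pair e ∣ ℕ.≟ 2)

pair-injective : ∀ e f → pair e ≡ pair f → e ≡ f
pair-injective = from-yes (Fin.all? λ e → Fin.all? λ f →
  (pair e ≟ˢ pair f) →-dec (e Fin.≟ f))

pair-surjective : ∀ p → ∣ p ∣ ≡ 2 → ∃[ e ] pair e ≡ p
pair-surjective p ∣p∣≡2 = decidable-stable (listed? p) λ ¬listed →
  from-no (Subset.anySubset? λ q → (∣ q ∣ ℕ.≟ 2) ×-dec ¬? (listed? q))
    (p , ∣p∣≡2 , ¬listed)
  where
  listed? = λ q → Fin.any? λ e → pair e ≟ˢ q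

private
  e01 e02 e03 e04 e05 e12 e13 e14 e15 e23 e24 e25 e34 e35 e45 : Fin 15
  e01 = # 0
  e02 = # 1
  e03 = # 2
  e04 = # 3
  e05 = # 4
  e12 = # 5
  e13 = # 6
  e14 = # 7
  e15 = # 8
  e23 = # 9
  e24 = # 10
  e25 = # 11
  e34 = # 12
  e35 = # 13
  e45 = # 14

K₆-incidence : BipartiteGraph 15 6
K₆-incidence = record
  { edges  = filter incident? (cartesianProduct (allFin 15) (allFin 6))
  ; unique = Unique.filter⁺ incident?
               (Unique.cartesianProduct⁺ (Unique.allFin⁺ 15) (Unique.allFin⁺ 6))
  }
  where incident? = λ (e , v) → v Subset.∈? pair e

K₆-2edges : List (TwoEdge 15 6)
K₆-2edges =
  ⟨ e01 , # 2 ⨾ e35 , # 4 ⟩ ∷ ⟨ e01 , # 3 ⨾ e45 , # 2 ⟩ ∷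
  ⟨ e02 , # 1 ⨾ e34 , # 5 ⟩ ∷ ⟨ e02 , # 3 ⨾ e14 , # 5 ⟩ ∷
  ⟨ e04 , # 3 ⨾ e15 , # 2 ⟩ ∷ ⟨ e04 , # 5 ⨾ e12 , # 3 ⟩ ∷
  ⟨ e05 , # 3 ⨾ e24 , # 1 ⟩ ∷ ⟨ e05 , # 4 ⨾ e23 , # 1 ⟩ ∷
  ⟨ e13 , # 0 ⨾ e24 , # 5 ⟩ ∷ ⟨ e14 , # 2 ⨾ e35 , # 0 ⟩ ∷
  ⟨ e15 , # 4 ⨾ e23 , # 0 ⟩ ∷ ⟨ e25 , # 1 ⨾ e34 , # 0 ⟩ ∷
  ⟨ e03 , # 5 ⨾ e25 , # 4 ⟩ ∷ ⟨ e13 , # 2 ⨾ e03 , # 4 ⟩ ∷ []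

K₆-augmented : AugmentedGraph 15 6
K₆-augmented = record
  { G₁        = K₆-incidence
  ; E₂        = K₆-2edges
  ; E₂-unique = from-yes (allPairs? (λ e f → ¬? (e ≃? f)) K₆-2edges)
  }

-- The form Σ_{(i,j)∈E₁} (xᵢyⱼ)² + Σ_{(i,j;k,l)∈E₂} (xᵢyⱼ + xₖyₗ)² attains the
-- bound.  Given another decomposition Σₚ fₚ², let v(i,j) be the vector of the
-- coefficients of xᵢyⱼ in the fₚ.  Comparing coefficients fixes all norms, all
-- inner products along a row or column, and v(i,j)·v(k,l) + v(i,l)·v(k,j).  An
-- unoccupied cell has v = 0, which fixes the inner product of the two cells it
-- is opposite to; following the acyclic dependency graph, W2′ and W3 propagate
-- this until the two halves of every 2-edge have the same unit vector and
-- different edges have orthogonal ones.  So |E₁| + |E₂| orthonormal vectors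
-- live in ℝʳ, and Bessel's inequality gives |E₁| + |E₂| ≤ r.

module Submission where

open import Defs
open import Algebra.Bundles using (CommutativeRing)
import Algebra.Properties.Group as GroupProperties
import Algebra.Properties.Semiring.Sum as SemiringSum
import Algebra.Solver.Ring.NaturalCoefficients.Default as SemiringSolver
open import Data.Bool using (if_then_else_)
open import Data.Fin as Fin using (Fin; zero; suc; splitAt)
import Data.Fin.Properties as Fin
import Data.Fin.Subset.Properties as Subset
open import Data.List using (List; []; _∷_; length; lookup; filter; allFin; cartesianProduct)
open import Data.List.Membership.Propositional using (_∈_; _∉_; find; lose)
open import Data.List.Membership.Propositional.Properties
  using (∈-lookup; ∈-filter⁺; ∈-filter⁻; ∈-cartesianProduct⁺; ∈-allFin)
open import Data.List.Relation.Unary.All as All using (All)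
open import Data.List.Relation.Unary.AllPairs using (AllPairs; []; _∷_)
open import Data.List.Relation.Unary.Any as Any using (Any; here; there)
open import Data.List.Relation.Unary.Any.Properties using (lookup-index)
open import Data.List.Relation.Unary.Linked using (_∷_)
open import Data.Nat as ℕ using (ℕ; zero; suc; _⊔_; z≤n; s≤s)
import Data.Nat.Properties as ℕ
open import Data.Product using (_×_; _,_; ∃-syntax; proj₁; proj₂)
open import Data.Rational as ℚ using (ℚ; 0ℚ; 1ℚ; ½)
import Data.Rational.Properties as ℚ
open import Data.Rational.Solver using (module +-*-Solver)
open import Data.Sum as Sum using (_⊎_; inj₁; inj₂)
open import Data.Sum.Properties using (inj₂-injective)
open import Function using (_∘_; flip)
open import Induction.WellFounded using (WellFounded; Acc; acc; wf⇒asym)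
open import Level using (0ℓ)
open import Relation.Binary using (IsEquivalence; Symmetric; tri<; tri≈; tri>)
open import Relation.Binary.PropositionalEquality as ≡ using (_≡_; _≢_; cong; subst)
import Relation.Binary.Reasoning.Setoid as SetoidReasoning
open import Relation.Nullary using (¬_; Dec; yes; no; does; contradiction)
open import Relation.Nullary.Decidable
  using (from-yes; map′; ¬?; _×-dec_; _⊎-dec_; _→-dec_; dec-true; dec-false; decidable-stable)

open ℝ

-- A coefficient fixes only the sum of two inner products, one for each diagonal of a rectangle of
-- cells; one product is recovered only once the other is known, hence the induction along arcs. It
-- assumes that the arcs are well-founded, which excludes even the complementary 2-cycles that W2
-- admits. In the graph at hand no two arcs are consecutive, so this holds at once.
--
-- Cauchy reals have no decidable equality, so a dimension count by elimination could not choose its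
-- pivots. Bessel's inequality is instead kept as an identity with an explicit nonnegative defect,
-- and the count is read off in the ring. Apart from halving and 1 ≠ 0, two facts about ℝ matter: a
-- vanishing sum of nonnegative terms has vanishing terms, and a vanishing square has a vanishing
-- root. The linear algebra is done over any ring with these properties.
--
-- The value z(15,6) = 30 has to be established as well. A C₄-free graph has at most one edge for
-- each row and one for each pair of columns; the incidence graph of K₆ attains 15 + C(6,2), because
-- every pair of columns is the neighbourhood of exactly one row.

-- The Cauchy reals as a formally real commutative ring.

Null : (ℕ → ℚ) → Set
Null s = ∀ ε → 0ℚ ℚ.< ε → ∃[ N ] (∀ n → N ℕ.≤ n → ℚ.∣ s n ∣ ℚ.< ε)

null-resp : ∀ {s t} → (∀ n → s n ≡ t n) → Null s → Null t
null-resp eq s-null ε ε>0 with s-null ε ε>0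
... | N , small = N , λ n N≤n → subst (λ q → ℚ.∣ q ∣ ℚ.< ε) (eq n) (small n N≤n)

null-0 : Null (λ _ → 0ℚ)
null-0 ε ε>0 = 0 , λ _ _ → ε>0

null-neg : ∀ {s} → Null s → Null (λ n → ℚ.- s n)
null-neg {s} s-null ε ε>0 with s-null ε ε>0
... | N , small = N , λ n N≤n → subst (ℚ._< ε) (≡.sym (ℚ.∣-p∣≡∣p∣ (s n))) (small n N≤n)

null-+ : ∀ {s t} → Null s → Null t → Null (λ n → s n ℚ.+ t n)
null-+ {s} {t} s-null t-null ε ε>0
  with s-null (½ ℚ.* ε) ε/2>0 | t-null (½ ℚ.* ε) ε/2>0
  where
  ε/2>0 : 0ℚ ℚ.< ½ ℚ.* ε
  ε/2>0 = ℚ.positive⁻¹ (½ ℚ.* ε) {{ℚ.pos*pos⇒pos ½ ε {{ℚ.positive ε>0}}}}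
... | M , s-small | N , t-small = M ⊔ N , λ n ≤n → begin-strict
  ℚ.∣ s n ℚ.+ t n ∣          ≤⟨ ℚ.∣p+q∣≤∣p∣+∣q∣ (s n) (t n) ⟩
  ℚ.∣ s n ∣ ℚ.+ ℚ.∣ t n ∣    <⟨ ℚ.+-mono-< (s-small n (ℕ.m⊔n≤o⇒m≤o M N ≤n))
                                          (t-small n (ℕ.m⊔n≤o⇒n≤o M N ≤n)) ⟩
  ½ ℚ.* ε ℚ.+ ½ ℚ.* ε        ≡⟨ solve 1 (λ ε → con ½ :* ε :+ con ½ :* ε := ε) ≡.refl ε ⟩
  ε                          ∎
  where
  open ℚ.≤-Reasoning
  open +-*-Solver

cauchy⇒bounded : ∀ {s} → IsCauchy s →
  ∃[ B ] 0ℚ ℚ.< B × ∃[ N ] (∀ n → N ℕ.≤ n → ℚ.∣ s n ∣ ℚ.≤ B)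
cauchy⇒bounded {s} s-cauchy with s-cauchy 1ℚ (ℚ.positive⁻¹ 1ℚ)
... | N , close = 1ℚ ℚ.+ ℚ.∣ s N ∣
                , ℚ.+-mono-<-≤ (ℚ.positive⁻¹ 1ℚ) (ℚ.0≤∣p∣ (s N))
                , N , λ n N≤n → begin
  ℚ.∣ s n ∣                          ≡⟨ cong ℚ.∣_∣ (solve 2 (λ a b → a := (a :- b) :+ b)
                                                     ≡.refl (s n) (s N)) ⟩
  ℚ.∣ (s n ℚ.- s N) ℚ.+ s N ∣        ≤⟨ ℚ.∣p+q∣≤∣p∣+∣q∣ (s n ℚ.- s N) (s N) ⟩
  ℚ.∣ s n ℚ.- s N ∣ ℚ.+ ℚ.∣ s N ∣    ≤⟨ ℚ.+-monoˡ-≤ ℚ.∣ s N ∣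
                                          (ℚ.<⇒≤ (close n N N≤n ℕ.≤-refl)) ⟩
  1ℚ ℚ.+ ℚ.∣ s N ∣                   ∎
  where
  open ℚ.≤-Reasoning
  open +-*-Solver

divide : ∀ B ε → 0ℚ ℚ.< B → 0ℚ ℚ.< ε → ∃[ δ ] 0ℚ ℚ.< δ × δ ℚ.* B ≡ ε
divide B ε B>0 ε>0 = ε ℚ.* B⁻¹ , ℚ.positive⁻¹ (ε ℚ.* B⁻¹) {{ℚ.pos*pos⇒pos ε B⁻¹}} ,
  ≡.trans (ℚ.*-assoc ε B⁻¹ B) (≡.trans (cong (ε ℚ.*_) (ℚ.*-inverseˡ B)) (ℚ.*-identityʳ ε))
  where
  instance
    ε-positive = ℚ.positive ε>0
    B-positive = ℚ.positive B>0
    B-nonZero  = ℚ.pos⇒nonZero B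
  B⁻¹ = ℚ.1/ B
  instance
    B⁻¹-positive = ℚ.1/pos⇒pos B

∣*∣-bound : ∀ p q {δ B} → 0ℚ ℚ.< B → ℚ.∣ p ∣ ℚ.< δ → ℚ.∣ q ∣ ℚ.≤ B →
            ℚ.∣ p ℚ.* q ∣ ℚ.< δ ℚ.* B
∣*∣-bound p q {δ} {B} B>0 ∣p∣<δ ∣q∣≤B = begin-strict
  ℚ.∣ p ℚ.* q ∣          ≡⟨ ℚ.∣p*q∣≡∣p∣*∣q∣ p q ⟩
  ℚ.∣ p ∣ ℚ.* ℚ.∣ q ∣    ≤⟨ ℚ.*-monoˡ-≤-nonNeg ℚ.∣ p ∣ {{ℚ.∣-∣-nonNeg p}} ∣q∣≤B ⟩
  ℚ.∣ p ∣ ℚ.* B          <⟨ ℚ.*-monoˡ-<-pos B {{ℚ.positive B>0}} ∣p∣<δ ⟩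
  δ ℚ.* B                ∎
  where open ℚ.≤-Reasoning

null-* : ∀ {s t} → Null s → IsCauchy t → Null (λ n → s n ℚ.* t n)
null-* {s} {t} s-null t-cauchy ε ε>0 =
  let B , B>0 , M , bound = cauchy⇒bounded {t} t-cauchy
      δ , δ>0 , δB≡ε      = divide B ε B>0 ε>0
      N , small           = s-null δ δ>0
  in M ⊔ N , λ n ≤n → subst (ℚ.∣ s n ℚ.* t n ∣ ℚ.<_) δB≡ε
       (∣*∣-bound (s n) (t n) B>0 (small n (ℕ.m⊔n≤o⇒n≤o M N ≤n))
                                   (bound n (ℕ.m⊔n≤o⇒m≤o M N ≤n)))

pointwise⇒≈ : ∀ {x y} → (∀ n → seq x n ≡ seq y n) → x ≈ y
pointwise⇒≈ {x} {y} eq = null-resp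
  (λ n → ≡.sym (≡.trans (cong (ℚ._- seq y n) (eq n)) (ℚ.+-inverseʳ (seq y n)))) null-0

-ᴿ_ : ℝ → ℝ
-ᴿ x = record { seq = λ n → ℚ.- seq x n
              ; cauchy = λ ε ε>0 → let N , close = cauchy x ε ε>0 in
                  N , λ m n N≤m N≤n → subst (ℚ._< ε)
                    (≡.trans (≡.sym (ℚ.∣-p∣≡∣p∣ (seq x m ℚ.- seq x n)))
                      (cong ℚ.∣_∣ (ℚ.neg-distrib-+ (seq x m) (ℚ.- seq x n))))
                    (close m n N≤m N≤n)
              }

-- `x ≈ y` unfolds to `Null` of the termwise difference, so each law is a rational identity under
-- `null-resp` together with a closure property of null sequences.
≈-isEquivalence : IsEquivalence _≈_
≈-isEquivalence = record
  { refl  = λ {x} → pointwise⇒≈ {x} {x} λ _ → ≡.refl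
  ; sym   = λ {x} {y} x≈y → null-resp
      (λ n → solve 2 (λ a b → :- (a :- b) := b :- a) ≡.refl (seq x n) (seq y n))
      (null-neg x≈y)
  ; trans = λ {x} {y} {z} x≈y y≈z → null-resp
      (λ n → solve 3 (λ a b c → (a :- b) :+ (b :- c) := a :- c)
               ≡.refl (seq x n) (seq y n) (seq z n))
      (null-+ x≈y y≈z)
  }
  where open +-*-Solver

ℝ-commutativeRing : CommutativeRing _ _
ℝ-commutativeRing = record
  { Carrier = ℝ ; _≈_ = _≈_ ; _+_ = _+ᴿ_ ; _*_ = _*ᴿ_ ; -_ = -ᴿ_
  ; 0# = 0ℝ ; 1# = fromℚ 1ℚ
  ; isCommutativeRing = record
    { isRing = record
      { +-isAbelianGroup = record
        { isGroup = record
          { isMonoid = record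
            { isSemigroup = record
              { isMagma = record
                { isEquivalence = ≈-isEquivalence
                ; ∙-cong = λ {x} {y} {u} {v} x≈y u≈v → null-resp
                    (λ n → solve 4 (λ x y u v → (x :- y) :+ (u :- v) := (x :+ u) :- (y :+ v))
                             ≡.refl (seq x n) (seq y n) (seq u n) (seq v n))
                    (null-+ x≈y u≈v)
                }
              ; assoc = λ x y z → pointwise⇒≈ {(x +ᴿ y) +ᴿ z} {x +ᴿ (y +ᴿ z)}
                  λ n → ℚ.+-assoc (seq x n) (seq y n) (seq z n)
              }
            ; identity = (λ x → pointwise⇒≈ {0ℝ +ᴿ x} {x} λ n → ℚ.+-identityˡ (seq x n))
                       , (λ x → pointwise⇒≈ {x +ᴿ 0ℝ} {x} λ n → ℚ.+-identityʳ (seq x n))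
            }
          ; inverse = (λ x → pointwise⇒≈ {(-ᴿ x) +ᴿ x} {0ℝ} λ n → ℚ.+-inverseˡ (seq x n))
                    , (λ x → pointwise⇒≈ {x +ᴿ (-ᴿ x)} {0ℝ} λ n → ℚ.+-inverseʳ (seq x n))
          ; ⁻¹-cong = λ {x} {y} x≈y → null-resp
              (λ n → solve 2 (λ x y → :- (x :- y) := (:- x) :- (:- y)) ≡.refl (seq x n) (seq y n))
              (null-neg x≈y)
          }
        ; comm = λ x y → pointwise⇒≈ {x +ᴿ y} {y +ᴿ x} λ n → ℚ.+-comm (seq x n) (seq y n)
        }
      -- The difference xu - yv is split so that each null difference meets a single Cauchy factor,
      -- which is eventually bounded.
      ; *-cong = λ {x} {y} {u} {v} x≈y u≈v → null-resp
          (λ n → solve 4 (λ x y u v → (x :- y) :* u :+ (u :- v) :* y := (x :* u) :- (y :* v))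
                   ≡.refl (seq x n) (seq y n) (seq u n) (seq v n))
          (null-+ (null-* x≈y (cauchy u)) (null-* u≈v (cauchy y)))
      ; *-assoc = λ x y z → pointwise⇒≈ {(x *ᴿ y) *ᴿ z} {x *ᴿ (y *ᴿ z)}
          λ n → ℚ.*-assoc (seq x n) (seq y n) (seq z n)
      ; *-identity = (λ x → pointwise⇒≈ {fromℚ 1ℚ *ᴿ x} {x} λ n → ℚ.*-identityˡ (seq x n))
                   , (λ x → pointwise⇒≈ {x *ᴿ fromℚ 1ℚ} {x} λ n → ℚ.*-identityʳ (seq x n))
      ; distrib = (λ x y z → pointwise⇒≈ {x *ᴿ (y +ᴿ z)} {x *ᴿ y +ᴿ x *ᴿ z}
                      λ n → ℚ.*-distribˡ-+ (seq x n) (seq y n) (seq z n))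
                , (λ x y z → pointwise⇒≈ {(y +ᴿ z) *ᴿ x} {y *ᴿ x +ᴿ z *ᴿ x}
                      λ n → ℚ.*-distribʳ-+ (seq x n) (seq y n) (seq z n))
      }
    ; *-comm = λ x y → pointwise⇒≈ {x *ᴿ y} {y *ᴿ x} λ n → ℚ.*-comm (seq x n) (seq y n)
    }
  }
  where open +-*-Solver

-- NonNegative is not required to respect equality: over ℝ it is termwise
-- nonnegativity of the Cauchy sequence.
record FormallyRealRing : Set₁ where
  field
    commutativeRing : CommutativeRing 0ℓ 0ℓ

  open CommutativeRing commutativeRing public hiding (zero) renaming (_≈_ to _≋_)

  field
    half               : Carrier
    half-double        : ∀ x → half * (x + x) ≋ x
    NonNegative        : Carrier → Set
    0-nonNegative      : NonNegative 0#
    1-nonNegative      : NonNegative 1#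
    +-nonNegative      : ∀ {x y} → NonNegative x → NonNegative y → NonNegative (x + y)
    square-nonNegative : ∀ x → NonNegative (x * x)
    summand≈0          : ∀ {x y} → NonNegative x → NonNegative y → x + y ≋ 0# → x ≋ 0#
    square≈0           : ∀ {x} → x * x ≋ 0# → x ≋ 0#
    1≉0                : ¬ (1# ≋ 0#)

ℝ-formallyReal : FormallyRealRing
ℝ-formallyReal = record
  { commutativeRing    = ℝ-commutativeRing
  ; half               = fromℚ ½
  ; half-double        = λ x → pointwise⇒≈ {fromℚ ½ *ᴿ (x +ᴿ x)} {x} λ n →
      solve 1 (λ a → con ½ :* (a :+ a) := a) ≡.refl (seq x n)
  ; NonNegative        = λ x → ∀ n → 0ℚ ℚ.≤ seq x n
  ; 0-nonNegative      = λ _ → ℚ.≤-refl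
  ; 1-nonNegative      = λ _ → ℚ.<⇒≤ (ℚ.positive⁻¹ 1ℚ)
  ; +-nonNegative      = λ x≥0 y≥0 n → ℚ.+-mono-≤ (x≥0 n) (y≥0 n)
  ; square-nonNegative = λ x n → ℚ-square≥0 (seq x n)
  -- Termwise nonnegativity gives |xₙ| ≤ |xₙ + yₙ|, so the modulus found for the sum also serves for
  -- x.
  ; summand≈0          = λ {x} {y} x≥0 y≥0 x+y≈0 ε ε>0 →
      let N , small = x+y≈0 ε ε>0
      in N , λ n N≤n → ℚ.≤-<-trans (≤⇒∣-0∣≤ (x≥0 n) (y≥0 n)) (small n N≤n)
  -- The modulus of x² is taken at ε², since |q|² < ε² forces |q| < ε.
  ; square≈0           = λ {x} x²≈0 ε ε>0 →
      let N , small = x²≈0 (ε ℚ.* ε)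
                        (ℚ.positive⁻¹ (ε ℚ.* ε)
                          {{ℚ.pos*pos⇒pos ε {{ℚ.positive ε>0}} ε {{ℚ.positive ε>0}}}})
      in N , λ n N≤n → square-small (seq x n) ε>0 (small n N≤n)
  ; 1≉0                = λ 1≈0 →
      let N , small = 1≈0 1ℚ (ℚ.positive⁻¹ 1ℚ)
      in ℚ.<-irrefl ≡.refl (small N ℕ.≤-refl)
  }
  where
  open +-*-Solver

  ℚ-square≥0 : ∀ q → 0ℚ ℚ.≤ q ℚ.* q
  ℚ-square≥0 q with ℚ.≤-total 0ℚ q
  ... | inj₁ q≥0 = ℚ.nonNegative⁻¹ (q ℚ.* q)
    {{ℚ.nonNeg*nonNeg⇒nonNeg q {{ℚ.nonNegative q≥0}} q {{ℚ.nonNegative q≥0}}}}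
  ... | inj₂ q≤0 = ℚ.nonNegative⁻¹ (q ℚ.* q)
    {{ℚ.nonPos*nonPos⇒nonPos q {{ℚ.nonPositive q≤0}} q {{ℚ.nonPositive q≤0}}}}

  ≤⇒∣-0∣≤ : ∀ {p q} → 0ℚ ℚ.≤ p → 0ℚ ℚ.≤ q → ℚ.∣ p ℚ.- 0ℚ ∣ ℚ.≤ ℚ.∣ (p ℚ.+ q) ℚ.- 0ℚ ∣
  ≤⇒∣-0∣≤ {p} {q} p≥0 q≥0 = begin
    ℚ.∣ p ℚ.- 0ℚ ∣           ≡⟨ cong ℚ.∣_∣ (ℚ.+-identityʳ p) ⟩
    ℚ.∣ p ∣                  ≡⟨ ℚ.0≤p⇒∣p∣≡p p≥0 ⟩
    p                        ≡⟨ ℚ.+-identityʳ p ⟨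
    p ℚ.+ 0ℚ                 ≤⟨ ℚ.+-monoʳ-≤ p q≥0 ⟩
    p ℚ.+ q                  ≡⟨ ℚ.0≤p⇒∣p∣≡p (ℚ.+-mono-≤ p≥0 q≥0) ⟨
    ℚ.∣ p ℚ.+ q ∣            ≡⟨ cong ℚ.∣_∣ (ℚ.+-identityʳ (p ℚ.+ q)) ⟨
    ℚ.∣ (p ℚ.+ q) ℚ.- 0ℚ ∣   ∎
    where open ℚ.≤-Reasoning

  square-small : ∀ q {ε} → 0ℚ ℚ.< ε → ℚ.∣ q ℚ.* q ℚ.- 0ℚ ∣ ℚ.< ε ℚ.* ε → ℚ.∣ q ℚ.- 0ℚ ∣ ℚ.< ε
  square-small q {ε} ε>0 q²<ε² = subst (λ p → ℚ.∣ p ∣ ℚ.< ε) (≡.sym (ℚ.+-identityʳ q))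
    (ℚ.≰⇒> λ ε≤∣q∣ → ℚ.<-irrefl ≡.refl (ℚ.<-≤-trans q²<ε² (begin
      ε ℚ.* ε                    ≤⟨ ℚ.*-monoˡ-≤-nonNeg ε {{ℚ.nonNegative (ℚ.<⇒≤ ε>0)}} ε≤∣q∣ ⟩
      ε ℚ.* ℚ.∣ q ∣              ≤⟨ ℚ.*-monoʳ-≤-nonNeg ℚ.∣ q ∣ {{ℚ.∣-∣-nonNeg q}} ε≤∣q∣ ⟩
      ℚ.∣ q ∣ ℚ.* ℚ.∣ q ∣        ≡⟨ ℚ.∣p*q∣≡∣p∣*∣q∣ q q ⟨
      ℚ.∣ q ℚ.* q ∣              ≡⟨ cong ℚ.∣_∣ (ℚ.+-identityʳ (q ℚ.* q)) ⟨
      ℚ.∣ q ℚ.* q ℚ.- 0ℚ ∣       ∎)))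
    where open ℚ.≤-Reasoning

-- Dot products, Bessel's inequality and the size of orthonormal families.

module DotProduct (F : FormallyRealRing) where

  open FormallyRealRing F
  open GroupProperties +-group using () renaming (∙-cancelˡ to +-cancelˡ)
  open SemiringSum semiring public
    using (sum; sum-cong-≋; sum-remove; sum-replicate-zero; ∑-distrib-+; ∑-comm;
           *-distribˡ-sum; *-distribʳ-sum)
  open SemiringSolver commutativeSemiring using (solve; _:+_; _:*_; _:=_)
  open SetoidReasoning setoid

  double-cancel : ∀ {x y} → x + x ≋ y + y → x ≋ y
  double-cancel {x} {y} 2x≈2y = begin
    x              ≈⟨ half-double x ⟨
    half * (x + x) ≈⟨ *-congˡ 2x≈2y ⟩
    half * (y + y) ≈⟨ half-double y ⟩
    y              ∎

  cancel-summand : ∀ {a b c d} → a + b ≋ c + d → a ≋ c → b ≋ d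
  cancel-summand {a} {b} {c} {d} a+b≈c+d a≈c =
    +-cancelˡ a b d (trans a+b≈c+d (+-congʳ (sym a≈c)))

  sum-nonNegative : ∀ {n} (t : Fin n → Carrier) → (∀ i → NonNegative (t i)) → NonNegative (sum t)
  sum-nonNegative {zero}  t t≥0 = 0-nonNegative
  sum-nonNegative {suc n} t t≥0 = +-nonNegative (t≥0 zero) (sum-nonNegative (t ∘ suc) (t≥0 ∘ suc))

  sum≈0⇒≈0 : ∀ {n} (t : Fin n → Carrier) → (∀ i → NonNegative (t i)) →
             sum t ≋ 0# → ∀ i → t i ≋ 0#
  sum≈0⇒≈0 {suc n} t t≥0 ∑t≈0 zero    =
    summand≈0 (t≥0 zero) (sum-nonNegative (t ∘ suc) (t≥0 ∘ suc)) ∑t≈0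
  sum≈0⇒≈0 {suc n} t t≥0 ∑t≈0 (suc i) = sum≈0⇒≈0 (t ∘ suc) (t≥0 ∘ suc)
    (summand≈0 (sum-nonNegative (t ∘ suc) (t≥0 ∘ suc)) (t≥0 zero) (trans (+-comm _ _) ∑t≈0)) i

  sum-zero : ∀ {n} (t : Fin n → Carrier) → (∀ i → t i ≋ 0#) → sum t ≋ 0#
  sum-zero {n} t t≈0 = trans (sum-cong-≋ t≈0) (sum-replicate-zero n)

  sum-single : ∀ {n} (i : Fin n) (t : Fin n → Carrier) → (∀ j → j ≢ i → t j ≋ 0#) → sum t ≋ t i
  sum-single {suc n} i t others≈0 = begin
    sum t                              ≈⟨ sum-remove {i = i} t ⟩
    t i + sum (t ∘ Fin.punchIn i)      ≈⟨ +-congˡ (sum-zero _ λ j →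
                                            others≈0 (Fin.punchIn i j) (Fin.punchInᵢ≢i i j)) ⟩
    t i + 0#                           ≈⟨ +-identityʳ (t i) ⟩
    t i                                ∎

  indicator : ∀ {n} → Fin n → Fin n → Carrier
  indicator i j = if does (i Fin.≟ j) then 1# else 0#

  indicator-≡ : ∀ {n} (i : Fin n) → indicator i i ≋ 1#
  indicator-≡ i rewrite dec-true (i Fin.≟ i) ≡.refl = refl

  indicator-≢ : ∀ {n} {i j : Fin n} → i ≢ j → indicator i j ≋ 0#
  indicator-≢ {i = i} {j} i≢j rewrite dec-false (i Fin.≟ j) i≢j = refl

  infix  4 _≋ᵛ_
  infixl 6 _⊕_ _⊖_
  infix  7 _·_

  _≋ᵛ_ : ∀ {n} → (Fin n → Carrier) → (Fin n → Carrier) → Set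
  u ≋ᵛ v = ∀ p → u p ≋ v p

  _⊕_ : ∀ {n} → (Fin n → Carrier) → (Fin n → Carrier) → Fin n → Carrier
  (u ⊕ v) p = u p + v p

  _·_ : ∀ {n} → (Fin n → Carrier) → (Fin n → Carrier) → Carrier
  u · v = sum λ p → u p * v p

  ·-cong : ∀ {n} {u u′ v v′ : Fin n → Carrier} → u ≋ᵛ u′ → v ≋ᵛ v′ → u · v ≋ u′ · v′
  ·-cong u≈u′ v≈v′ = sum-cong-≋ λ p → *-cong (u≈u′ p) (v≈v′ p)

  ·-comm : ∀ {n} (u v : Fin n → Carrier) → u · v ≋ v · u
  ·-comm u v = sum-cong-≋ λ p → *-comm (u p) (v p)

  ·-distribʳ : ∀ {n} (u v w : Fin n → Carrier) → (u ⊕ v) · w ≋ u · w + v · w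
  ·-distribʳ u v w = trans (sum-cong-≋ λ p → distribʳ (w p) (u p) (v p))
                           (∑-distrib-+ (λ p → u p * w p) (λ p → v p * w p))

  ·-distribˡ : ∀ {n} (u v w : Fin n → Carrier) → u · (v ⊕ w) ≋ u · v + u · w
  ·-distribˡ u v w = trans (sum-cong-≋ λ p → distribˡ (u p) (v p) (w p))
                           (∑-distrib-+ (λ p → u p * v p) (λ p → u p * w p))

  ·-scale : ∀ {n} c (u v : Fin n → Carrier) → (λ p → c * u p) · v ≋ c * (u · v)
  ·-scale c u v = trans (sum-cong-≋ λ p → *-assoc c (u p) (v p))
                        (sym (*-distribˡ-sum c (λ p → u p * v p)))

  ·-sumˡ : ∀ {a n} (u : Fin a → Fin n → Carrier) v →
           (λ p → sum λ i → u i p) · v ≋ sum λ i → u i · v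
  ·-sumˡ u v = trans (sum-cong-≋ λ p → *-distribʳ-sum (v p) (λ i → u i p))
                     (∑-comm λ p i → u i p * v p)

  ·-sum : ∀ {a b n} (u : Fin a → Fin n → Carrier) (v : Fin b → Fin n → Carrier) →
          (λ p → sum λ i → u i p) · (λ p → sum λ j → v j p) ≋ sum λ i → sum λ j → u i · v j
  ·-sum u v = trans (·-sumˡ u _) (sum-cong-≋ λ i → begin
    u i · (λ p → sum λ j → v j p)    ≈⟨ ·-comm (u i) _ ⟩
    (λ p → sum λ j → v j p) · u i    ≈⟨ ·-sumˡ v (u i) ⟩
    sum (λ j → v j · u i)            ≈⟨ sum-cong-≋ (λ j → ·-comm (v j) (u i)) ⟩
    sum (λ j → u i · v j)            ∎)

  -- The grouping serves polarization: the first bracket is known to agree on both sides and is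
  -- removed by `cancel-summand`, which leaves the mixed terms.
  ·-expand : ∀ {n} (u u′ v v′ : Fin n → Carrier) →
             (u ⊕ u′) · (v ⊕ v′) ≋ (u · v + u′ · v′) + (u · v′ + u′ · v)
  ·-expand u u′ v v′ = begin
    (u ⊕ u′) · (v ⊕ v′)                        ≈⟨ ·-distribʳ u u′ (v ⊕ v′) ⟩
    u · (v ⊕ v′) + u′ · (v ⊕ v′)               ≈⟨ +-cong (·-distribˡ u v v′) (·-distribˡ u′ v v′) ⟩
    (u · v + u · v′) + (u′ · v + u′ · v′)      ≈⟨ solve 4 (λ a b c d →
                                                    (a :+ b) :+ (c :+ d) := (a :+ d) :+ (b :+ c))
                                                    refl _ _ _ _ ⟩
    (u · v + u′ · v′) + (u · v′ + u′ · v)      ∎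

  ·-nonNegative : ∀ {n} (u : Fin n → Carrier) → NonNegative (u · u)
  ·-nonNegative u = sum-nonNegative _ λ p → square-nonNegative (u p)

  ·-self≈0 : ∀ {n} {u : Fin n → Carrier} → u · u ≋ 0# → ∀ p → u p ≋ 0#
  ·-self≈0 {u = u} u·u≈0 p = square≈0 (sum≈0⇒≈0 _ (λ q → square-nonNegative (u q)) u·u≈0 p)

  _⊖_ : ∀ {n} → (Fin n → Carrier) → (Fin n → Carrier) → Fin n → Carrier
  (u ⊖ v) p = u p - v p

  -- With d = x - y as an indeterminate and x written as d + y, this is an identity of commutative
  -- semirings; the mixed term therefore stands on the right with a plus sign.
  square-difference : ∀ x y → x * x + y * y ≋ (x - y) * (x - y) + (x * y + x * y)
  square-difference x y = begin
    x * x + y * y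
      ≈⟨ +-cong (*-cong x≈ x≈) refl ⟩
    ((x - y) + y) * ((x - y) + y) + y * y
      ≈⟨ solve 2 (λ d y → (d :+ y) :* (d :+ y) :+ y :* y
                       := d :* d :+ ((d :+ y) :* y :+ (d :+ y) :* y)) refl (x - y) y ⟩
    (x - y) * (x - y) + (((x - y) + y) * y + ((x - y) + y) * y)
      ≈⟨ +-congˡ (+-cong (*-congʳ x≈) (*-congʳ x≈)) ⟨
    (x - y) * (x - y) + (x * y + x * y)
      ∎
    where
    x≈ : x ≋ (x - y) + y
    x≈ = sym (trans (+-assoc x (- y) y) (trans (+-congˡ (-‿inverseˡ y)) (+-identityʳ x)))

  ·-difference : ∀ {n} (u v : Fin n → Carrier) →
                 u · u + v · v ≋ (u ⊖ v) · (u ⊖ v) + (u · v + u · v)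
  ·-difference u v = begin
    u · u + v · v
      ≈⟨ ∑-distrib-+ (λ p → u p * u p) (λ p → v p * v p) ⟨
    sum (λ p → u p * u p + v p * v p)
      ≈⟨ sum-cong-≋ (λ p → square-difference (u p) (v p)) ⟩
    sum (λ p → (u p - v p) * (u p - v p) + (u p * v p + u p * v p))
      ≈⟨ ∑-distrib-+ (λ p → (u ⊖ v) p * (u ⊖ v) p) (λ p → u p * v p + u p * v p) ⟩
    (u ⊖ v) · (u ⊖ v) + sum (λ p → u p * v p + u p * v p)
      ≈⟨ +-congˡ (∑-distrib-+ (λ p → u p * v p) (λ p → u p * v p)) ⟩
    (u ⊖ v) · (u ⊖ v) + (u · v + u · v)
      ∎

  -- The equality case of Cauchy-Schwarz: the squared norm of u - v is 1 + 1 - 2 = 0, and a sum of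
  -- squares vanishes only term by term.
  unit-vectors-≈ : ∀ {n} {u v : Fin n → Carrier} →
                   u · u ≋ 1# → v · v ≋ 1# → u · v ≋ 1# → u ≋ᵛ v
  unit-vectors-≈ {u = u} {v} u·u≈1 v·v≈1 u·v≈1 p = begin
    u p                ≈⟨ +-identityʳ (u p) ⟨
    u p + 0#           ≈⟨ +-congˡ (-‿inverseˡ (v p)) ⟨
    u p + (- v p + v p) ≈⟨ +-assoc _ _ _ ⟨
    (u p - v p) + v p  ≈⟨ +-congʳ (·-self≈0 difference≈0 p) ⟩
    0# + v p           ≈⟨ +-identityˡ (v p) ⟩
    v p                ∎
    where
    difference≈0 : (u ⊖ v) · (u ⊖ v) ≋ 0#
    difference≈0 = cancel-summand
      (begin
        (1# + 1#) + (u ⊖ v) · (u ⊖ v)        ≈⟨ +-comm _ _ ⟩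
        (u ⊖ v) · (u ⊖ v) + (1# + 1#)        ≈⟨ +-congˡ (+-cong u·v≈1 u·v≈1) ⟨
        (u ⊖ v) · (u ⊖ v) + (u · v + u · v)  ≈⟨ ·-difference u v ⟨
        u · u + v · v                        ≈⟨ +-cong u·u≈1 v·v≈1 ⟩
        1# + 1#                              ≈⟨ +-identityʳ _ ⟨
        (1# + 1#) + 0#                       ∎)
      refl

  Orthonormal : ∀ {N r} → (Fin N → Fin r → Carrier) → Set
  Orthonormal v = (∀ a → v a · v a ≋ 1#) × (∀ {a b} → a ≢ b → v a · v b ≋ 0#)

  -- The defect d is the squared distance from u to its projection s onto the span of the family. It
  -- is returned as data in an equation because `NonNegative` need not respect `≋`, so that
  -- nonnegativity of a difference would be too rigid a statement.
  bessel : ∀ {N r} (v : Fin N → Fin r → Carrier) → Orthonormal v → ∀ u →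
           ∃[ d ] NonNegative d × u · u ≋ d + sum λ a → (u · v a) * (u · v a)
  bessel {N} v (v-unit , v-orth) u = w · w , ·-nonNegative w , cancel-summand
      (begin
        S + u · u                 ≈⟨ +-comm S (u · u) ⟩
        u · u + S                 ≈⟨ +-congˡ s·s≈S ⟨
        u · u + s · s             ≈⟨ ·-difference u s ⟩
        w · w + (u · s + u · s)   ≈⟨ +-congˡ (+-cong u·s≈S u·s≈S) ⟩
        w · w + (S + S)           ≈⟨ solve 2 (λ w S → w :+ (S :+ S) := S :+ (w :+ S)) refl (w · w) S ⟩
        S + (w · w + S)           ∎)
      refl
    where
    c = λ a → u · v a
    s = λ p → sum λ a → c a * v a p
    w = u ⊖ s
    S = sum λ a → c a * c a

    s·_ : ∀ z → s · z ≋ sum λ a → c a * (v a · z)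
    s· z = trans (·-sumˡ (λ a p → c a * v a p) z) (sum-cong-≋ λ a → ·-scale (c a) (v a) z)

    u·s≈S : u · s ≋ S
    u·s≈S = begin
      u · s                          ≈⟨ ·-comm u s ⟩
      s · u                          ≈⟨ s· u ⟩
      sum (λ a → c a * (v a · u))    ≈⟨ sum-cong-≋ (λ a → *-congˡ (·-comm (v a) u)) ⟩
      S                              ∎

    s·v≈c : ∀ b → s · v b ≋ c b
    s·v≈c b = begin
      s · v b                          ≈⟨ s· v b ⟩
      sum (λ a → c a * (v a · v b))    ≈⟨ sum-single b _ (λ a a≢b →
                                            trans (*-congˡ (v-orth a≢b)) (zeroʳ (c a))) ⟩
      c b * (v b · v b)                ≈⟨ *-congˡ (v-unit b) ⟩
      c b * 1#                         ≈⟨ *-identityʳ (c b) ⟩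
      c b                              ∎

    s·s≈S : s · s ≋ S
    s·s≈S = trans (s· s) (sum-cong-≋ λ a → *-congˡ (trans (·-comm (v a) s) (s·v≈c a)))

  ones : ℕ → Carrier
  ones n = sum {n} λ _ → 1#

  ones-nonNegative : ∀ n → NonNegative (ones n)
  ones-nonNegative n = sum-nonNegative {n} (λ _ → 1#) (λ _ → 1-nonNegative)

  -- Ones are cancelled from both sides in step. If r ran out before N, then 1 would be a
  -- nonnegative summand of zero, hence zero; no comparison of ring elements is made.
  ones-≤ : ∀ {N r d} → NonNegative d → ones r ≋ d + ones N → N ℕ.≤ r
  ones-≤ {zero}          d≥0 eq = z≤n
  ones-≤ {suc N} {zero}  d≥0 eq = contradiction
    (summand≈0 1-nonNegative (+-nonNegative d≥0 (ones-nonNegative N))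
      (trans (solve 3 (λ a b c → a :+ (b :+ c) := b :+ (a :+ c)) refl _ _ _) (sym eq)))
    1≉0
  ones-≤ {suc N} {suc r} d≥0 eq = s≤s (ones-≤ d≥0
    (+-cancelˡ 1# _ _ (trans eq (solve 3 (λ a b c → b :+ (a :+ c) := a :+ (b :+ c)) refl _ _ _))))

  -- Bessel's inequality for the standard basis vectors of Rʳ, summed over
  -- the basis, compares r with the sum of the squared norms of the v a.
  orthonormal⇒≤ : ∀ {N r} (v : Fin N → Fin r → Carrier) → Orthonormal v → N ℕ.≤ r
  orthonormal⇒≤ {N} {r} v v-on@(v-unit , _) = ones-≤ (sum-nonNegative d d≥0) (begin
    sum {r} (λ _ → 1#)
      ≈⟨ sum-cong-≋ (λ p → sym (trans (e·_ p (e p)) (indicator-≡ p))) ⟩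
    sum (λ p → e p · e p)
      ≈⟨ sum-cong-≋ (λ p → proj₂ (proj₂ (bessel v v-on (e p)))) ⟩
    sum (λ p → d p + sum λ a → (e p · v a) * (e p · v a))
      ≈⟨ ∑-distrib-+ d _ ⟩
    sum d + sum (λ p → sum λ a → (e p · v a) * (e p · v a))
      ≈⟨ +-congˡ (sum-cong-≋ λ p → sum-cong-≋ λ a → *-cong (e·_ p (v a)) (e·_ p (v a))) ⟩
    sum d + sum (λ p → sum λ a → v a p * v a p)
      ≈⟨ +-congˡ (∑-comm (λ p a → v a p * v a p)) ⟩
    sum d + sum (λ a → v a · v a)
      ≈⟨ +-congˡ (sum-cong-≋ v-unit) ⟩
    sum d + ones N
      ∎)
    where
    e = indicator {r}
    d = λ p → proj₁ (bessel v v-on (e p))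
    d≥0 = λ p → proj₁ (proj₂ (bessel v v-on (e p)))
    e·_ : ∀ p z → e p · z ≋ z p
    e·_ p z = begin
      e p · z       ≈⟨ sum-single p _ (λ q q≢p →
                         trans (*-congʳ (indicator-≢ (q≢p ∘ ≡.sym))) (zeroˡ (z q))) ⟩
      e p p * z p   ≈⟨ *-congʳ (indicator-≡ p) ⟩
      1# * z p      ≈⟨ *-identityˡ (z p) ⟩
      z p           ∎

-- Gram matrices of families of bilinear forms and the biquadratic forms they define.

module BilinearFamilies (F : FormallyRealRing) where

  open FormallyRealRing F
  open DotProduct F
  open SemiringSolver commutativeSemiring using (solve; _:+_; _:*_; _:=_)
  open SetoidReasoning setoid

  eval : ∀ {m n} → (Fin m → Fin n → Carrier) → (Fin m → Carrier) → (Fin n → Carrier) → Carrier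
  eval b x y = sum λ i → sum λ j → b i j * x i * y j

  eval-indicator : ∀ {m n} (b : Fin m → Fin n → Carrier) i j →
                   eval b (indicator i) (indicator j) ≋ b i j
  eval-indicator b i j = begin
    eval b (indicator i) (indicator j)
      ≈⟨ sum-single i (λ k → sum λ l → b k l * indicator i k * indicator j l) (λ k k≢i →
           sum-zero (λ l → b k l * indicator i k * indicator j l) λ l →
           trans (*-congʳ (trans (*-congˡ (indicator-≢ (k≢i ∘ ≡.sym))) (zeroʳ (b k l))))
                 (zeroˡ (indicator j l))) ⟩
    sum (λ l → b i l * indicator i i * indicator j l)
      ≈⟨ sum-single j _ (λ l l≢j → trans (*-congˡ (indicator-≢ (l≢j ∘ ≡.sym))) (zeroʳ _)) ⟩
    b i j * indicator i i * indicator j j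
      ≈⟨ *-cong (trans (*-congˡ (indicator-≡ i)) (*-identityʳ _)) (indicator-≡ j) ⟩
    b i j * 1#
      ≈⟨ *-identityʳ _ ⟩
    b i j
      ∎

  eval-⊕ˡ : ∀ {m n} (b : Fin m → Fin n → Carrier) x x′ y →
            eval b (x ⊕ x′) y ≋ eval b x y + eval b x′ y
  eval-⊕ˡ b x x′ y = trans
    (sum-cong-≋ λ i → trans
      (sum-cong-≋ λ j → solve 4 (λ b x x′ y → b :* (x :+ x′) :* y := b :* x :* y :+ b :* x′ :* y)
                          refl (b i j) (x i) (x′ i) (y j))
      (∑-distrib-+ (λ j → b i j * x i * y j) (λ j → b i j * x′ i * y j)))
    (∑-distrib-+ (λ i → sum λ j → b i j * x i * y j) (λ i → sum λ j → b i j * x′ i * y j))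

  eval-⊕ʳ : ∀ {m n} (b : Fin m → Fin n → Carrier) x y y′ →
            eval b x (y ⊕ y′) ≋ eval b x y + eval b x y′
  eval-⊕ʳ b x y y′ = trans
    (sum-cong-≋ λ i → trans
      (sum-cong-≋ λ j → distribˡ (b i j * x i) (y j) (y′ j))
      (∑-distrib-+ (λ j → b i j * x i * y j) (λ j → b i j * x i * y′ j)))
    (∑-distrib-+ (λ i → sum λ j → b i j * x i * y j) (λ i → sum λ j → b i j * x i * y′ j))

  values : ∀ {r m n} → (Fin r → Fin m → Fin n → Carrier) →
           (Fin m → Carrier) → (Fin n → Carrier) → Fin r → Carrier
  values f x y p = eval (f p) x y

  normSquared : ∀ {r m n} → (Fin r → Fin m → Fin n → Carrier) →
                (Fin m → Carrier) → (Fin n → Carrier) → Carrier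
  normSquared f x y = values f x y · values f x y

  entry : ∀ {r m n} → (Fin r → Fin m → Fin n → Carrier) → Fin m × Fin n → Fin r → Carrier
  entry f (i , j) p = f p i j

  module _ {r s m n} (f : Fin r → Fin m → Fin n → Carrier) (g : Fin s → Fin m → Fin n → Carrier)
    (norms : ∀ x y → normSquared f x y ≋ normSquared g x y) where

    private
      polarized : ∀ x y y′ → values f x y · values f x y′ ≋ values g x y · values g x y′
      polarized x y y′ = double-cancel (cancel-summand
        (begin
          _ ≈⟨ expand f ⟨
          _ ≈⟨ norms x (y ⊕ y′) ⟩
          _ ≈⟨ expand g ⟩
          _ ∎)
        (+-cong (norms x y) (norms x y′)))
        where
        expand : ∀ {t} (h : Fin t → _) → values h x (y ⊕ y′) · values h x (y ⊕ y′) ≋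
          (values h x y · values h x y + values h x y′ · values h x y′) +
          (values h x y · values h x y′ + values h x y · values h x y′)
        expand h = begin
          _ ≈⟨ ·-cong (λ p → eval-⊕ʳ (h p) x y y′) (λ p → eval-⊕ʳ (h p) x y y′) ⟩
          _ ≈⟨ ·-expand (values h x y) (values h x y′) (values h x y) (values h x y′) ⟩
          _ ≈⟨ +-congˡ (+-congˡ (·-comm (values h x y′) (values h x y))) ⟩
          _ ∎

    -- This extracts the coefficient of xᵢxₖyⱼyₗ. Equality is given only between values, so it is
    -- polarized twice: in y with x arbitrary, then in x at eᵢ + eₖ. The cases i = k and j = l are
    -- included.
    gram-cross : ∀ i j k l →
      entry f (i , j) · entry f (k , l) + entry f (i , l) · entry f (k , j) ≋
      entry g (i , j) · entry g (k , l) + entry g (i , l) · entry g (k , j)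
    gram-cross i j k l = begin
      _ ≈⟨ at-indicators f ⟨
      _ ≈⟨ cancel-summand (trans (sym (expand f)) (trans (polarized (eᵢ ⊕ eₖ) eⱼ eₗ) (expand g)))
             (+-cong (polarized eᵢ eⱼ eₗ) (polarized eₖ eⱼ eₗ)) ⟩
      _ ≈⟨ at-indicators g ⟩
      _ ∎
      where
      eᵢ = indicator i
      eₖ = indicator k
      eⱼ = indicator j
      eₗ = indicator l
      expand : ∀ {t} (h : Fin t → _) → values h (eᵢ ⊕ eₖ) eⱼ · values h (eᵢ ⊕ eₖ) eₗ ≋
        (values h eᵢ eⱼ · values h eᵢ eₗ + values h eₖ eⱼ · values h eₖ eₗ) +
        (values h eᵢ eⱼ · values h eₖ eₗ + values h eₖ eⱼ · values h eᵢ eₗ)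
      expand h = trans
        (·-cong (λ p → eval-⊕ˡ (h p) eᵢ eₖ eⱼ) (λ p → eval-⊕ˡ (h p) eᵢ eₖ eₗ))
        (·-expand (values h eᵢ eⱼ) (values h eₖ eⱼ) (values h eᵢ eₗ) (values h eₖ eₗ))
      at-indicators : ∀ {t} (h : Fin t → _) →
        values h eᵢ eⱼ · values h eₖ eₗ + values h eₖ eⱼ · values h eᵢ eₗ ≋
        entry h (i , j) · entry h (k , l) + entry h (i , l) · entry h (k , j)
      at-indicators h = +-cong
        (·-cong (λ p → eval-indicator (h p) i j) (λ p → eval-indicator (h p) k l))
        (trans (·-cong (λ p → eval-indicator (h p) k j) (λ p → eval-indicator (h p) i l))
               (·-comm (entry h (k , j)) (entry h (i , l))))

  module _ {r m n} (f : Fin r → Fin m → Fin n → Carrier) where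

    private
      gram : Fin m → Fin n → Fin m → Fin n → Carrier
      gram i j k l = entry f (i , j) · entry f (k , l)

    -- A Gram matrix is invariant only under exchanging (i,j) with (k,l). Averaging over the
    -- exchange of j and l adds the required symmetry in i and k, and leaves the form unchanged
    -- because yⱼyₗ is symmetric.
    symmetrizedGram : Fin m → Fin n → Fin m → Fin n → Carrier
    symmetrizedGram i j k l = half * (gram i j k l + gram i l k j)

    symmetrizedGram-symˡ : ∀ i j k l → symmetrizedGram i j k l ≋ symmetrizedGram k j i l
    symmetrizedGram-symˡ i j k l = *-congˡ (trans (+-comm _ _)
      (+-cong (·-comm (entry f (i , l)) (entry f (k , j)))
              (·-comm (entry f (i , j)) (entry f (k , l)))))

    symmetrizedGram-symᵇ : ∀ i j k l → symmetrizedGram i j k l ≋ symmetrizedGram k l i j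
    symmetrizedGram-symᵇ i j k l = *-congˡ
      (+-cong (·-comm (entry f (i , j)) (entry f (k , l)))
              (·-comm (entry f (i , l)) (entry f (k , j))))

    private
      sum-symmetrize : ∀ (M : Fin n → Fin n → Carrier) →
        sum (λ j → sum λ l → half * (M j l + M l j)) ≋ sum λ j → sum λ l → M j l
      sum-symmetrize M = begin
        sum (λ j → sum λ l → half * (M j l + M l j))
          ≈⟨ sum-cong-≋ (λ j → *-distribˡ-sum half (λ l → M j l + M l j)) ⟨
        sum (λ j → half * sum λ l → M j l + M l j)
          ≈⟨ *-distribˡ-sum half (λ j → sum λ l → M j l + M l j) ⟨
        half * sum (λ j → sum λ l → M j l + M l j)
          ≈⟨ *-congˡ (trans (sum-cong-≋ (λ j → ∑-distrib-+ (M j) (λ l → M l j)))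
                            (∑-distrib-+ (λ j → sum (M j)) (λ j → sum λ l → M l j))) ⟩
        half * (sum (λ j → sum (M j)) + sum (λ j → sum λ l → M l j))
          ≈⟨ *-congˡ (+-congˡ (∑-comm λ j l → M l j)) ⟩
        half * (sum (λ j → sum (M j)) + sum (λ j → sum (M j)))
          ≈⟨ half-double _ ⟩
        sum (λ j → sum λ l → M j l)
          ∎

    symmetrizedForm : (Fin m → Carrier) → (Fin n → Carrier) → Carrier
    symmetrizedForm x y = sum λ i → sum λ k → sum λ j → sum λ l →
      symmetrizedGram i j k l * x i * x k * y j * y l

    symmetrizedForm-squares : ∀ x y → symmetrizedForm x y ≋ normSquared f x y
    symmetrizedForm-squares x y = begin
      -- The monomial is distributed over the two halves of the average, so that the second becomes
      -- `term i k` with j and l exchanged and the double sum averages a matrix with its transpose.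
      _ ≈⟨ (sum-cong-≋ λ i → sum-cong-≋ λ k → sum-cong-≋ λ j → sum-cong-≋ λ l →
             solve 7 (λ h g g′ xi xk yj yl →
                 h :* (g :+ g′) :* xi :* xk :* yj :* yl
                   := h :* (g :* (xi :* yj :* (xk :* yl)) :+ g′ :* (xi :* yl :* (xk :* yj))))
               refl half (gram i j k l) (gram i l k j) (x i) (x k) (y j) (y l)) ⟩
      _ ≈⟨ (sum-cong-≋ λ i → sum-cong-≋ λ k → sum-symmetrize (term i k)) ⟩
      _ ≈⟨ (sum-cong-≋ λ i → sum-cong-≋ λ k → sum-cong-≋ λ j → sum-cong-≋ λ l →
             sym (scaled i j k l)) ⟩
      _ ≈⟨ (sum-cong-≋ λ i → sum-cong-≋ λ k → ·-sum (part i) (part k)) ⟨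
      _ ≈⟨ ·-sum (λ i p → sum λ j → part i j p) (λ k p → sum λ l → part k l p) ⟨
      normSquared f x y ∎
      where
      term : Fin m → Fin m → Fin n → Fin n → Carrier
      term i k j l = gram i j k l * (x i * y j * (x k * y l))
      part : Fin m → Fin n → Fin r → Carrier
      part i j p = f p i j * x i * y j
      scaled : ∀ i j k l → part i j · part k l ≋ term i k j l
      scaled i j k l = begin
        part i j · part k l
          ≈⟨ sum-cong-≋ (λ p → solve 6 (λ a b xi xk yj yl →
               (a :* xi :* yj) :* (b :* xk :* yl) := (a :* b) :* (xi :* yj :* (xk :* yl)))
               refl (f p i j) (f p k l) (x i) (x k) (y j) (y l)) ⟩
        sum (λ p → (f p i j * f p k l) * (x i * y j * (x k * y l)))
          ≈⟨ *-distribʳ-sum (x i * y j * (x k * y l)) (λ p → f p i j * f p k l) ⟨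
        term i k j l
          ∎

lookup-AllPairs : ∀ {a ℓ} {A : Set a} {R : A → A → Set ℓ} → Symmetric R →
  ∀ {xs} → AllPairs R xs → ∀ {i j} → i ≢ j → R (lookup xs i) (lookup xs j)
lookup-AllPairs R-sym (_ ∷ _)    {zero}  {zero}  i≢j = contradiction ≡.refl i≢j
lookup-AllPairs R-sym (x∼xs ∷ _) {zero}  {suc j} i≢j = All.lookup x∼xs (∈-lookup j)
lookup-AllPairs R-sym (x∼xs ∷ _) {suc i} {zero}  i≢j = R-sym (All.lookup x∼xs (∈-lookup i))
lookup-AllPairs R-sym (_ ∷ rest) {suc i} {suc j} i≢j =
  lookup-AllPairs R-sym rest (i≢j ∘ cong suc)

-- 2-edges, cells and edges of an augmented graph.

module _ {m n : ℕ} where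

  open TwoEdge

  ≃-sym : ∀ (e f : TwoEdge m n) → e ≃ f → f ≃ e
  ≃-sym _ _ (inj₁ (p , q)) = inj₁ (≡.sym p , ≡.sym q)
  ≃-sym _ _ (inj₂ (p , q)) = inj₂ (≡.sym q , ≡.sym p)

  isHalfOf-resp-≃ : ∀ {c} (e f : TwoEdge m n) → e ≃ f → c isHalfOf e → c isHalfOf f
  isHalfOf-resp-≃ _ _ (inj₁ (p , _)) (inj₁ c≡) = inj₁ (≡.trans c≡ p)
  isHalfOf-resp-≃ _ _ (inj₁ (_ , q)) (inj₂ c≡) = inj₂ (≡.trans c≡ q)
  isHalfOf-resp-≃ _ _ (inj₂ (p , _)) (inj₁ c≡) = inj₂ (≡.trans c≡ p)
  isHalfOf-resp-≃ _ _ (inj₂ (_ , q)) (inj₂ c≡) = inj₁ (≡.trans c≡ q)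

  Collinear : Cell m n → Cell m n → Set
  Collinear c d = proj₁ c ≡ proj₁ d ⊎ proj₂ c ≡ proj₂ d

  collinear? : ∀ c d → Dec (Collinear c d)
  collinear? c d = (proj₁ c Fin.≟ proj₁ d) ⊎-dec (proj₂ c Fin.≟ proj₂ d)

  ¬collinear⇒nondegenerate : ∀ e → ¬ Collinear (half₁ e) (half₂ e) → Nondegenerate e
  ¬collinear⇒nondegenerate e ¬col = ¬col ∘ inj₁ , ¬col ∘ inj₂

  isHalfOf? : ∀ (c : Cell m n) (e : TwoEdge m n) → Dec (c isHalfOf e)
  isHalfOf? c e = (c ≟ᶜ half₁ e) ⊎-dec (c ≟ᶜ half₂ e)

  halves : TwoEdge m n → List (Cell m n)
  halves e = half₁ e ∷ half₂ e ∷ []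

module Edges {m n : ℕ} (G : AugmentedGraph m n) where

  open AugmentedGraph G

  cells : Edge → List (Cell m n)
  cells (one c _) = c ∷ []
  cells (two e _) = halves e

  cellOf⇒∈cells : ∀ a {c} → c cellOf a → c ∈ cells a
  cellOf⇒∈cells (one _ _) c≡        = here c≡
  cellOf⇒∈cells (two _ _) (inj₁ c≡) = here c≡
  cellOf⇒∈cells (two _ _) (inj₂ c≡) = there (here c≡)

  ∈cells⇒cellOf : ∀ a {c} → c ∈ cells a → c cellOf a
  ∈cells⇒cellOf (one _ _) (here c≡)         = c≡
  ∈cells⇒cellOf (two _ _) (here c≡)         = inj₁ c≡
  ∈cells⇒cellOf (two _ _) (there (here c≡)) = inj₂ c≡

  cellOf? : ∀ c a → Dec (c cellOf a)
  cellOf? c (one d _) = c ≟ᶜ d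
  cellOf? c (two e _) = isHalfOf? c e

module WeaklyAdmissible {m n : ℕ} {G : AugmentedGraph m n} (admissible : WeakAdmissible G) where

  open AugmentedGraph G
  open WeakAdmissible admissible
  open Edges G
  open TwoEdge

  edge⊎ : Fin ∣E₁∣ ⊎ Fin ∣E₂∣ → Edge
  edge⊎ (inj₁ i) = one (lookup E₁ i) (∈-lookup i)
  edge⊎ (inj₂ i) = two (lookup E₂ i) (∈-lookup i)

  edge : Fin (∣E₁∣ ℕ.+ ∣E₂∣) → Edge
  edge s = edge⊎ (splitAt ∣E₁∣ s)

  occupied? : ∀ c → Dec (Occupied c)
  occupied? c = Any.any? (c ≟ᶜ_) E₁ ⊎-dec Any.any? (isHalfOf? c) E₂

  cellOf⇒occupied : ∀ a {c} → c cellOf a → Occupied c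
  cellOf⇒occupied (one _ d∈) ≡.refl = inj₁ d∈
  cellOf⇒occupied (two _ e∈) c∈e    = inj₂ (lose e∈ c∈e)

  occupied⇒cellOf : ∀ {c} → Occupied c → ∃[ a ] c cellOf a
  occupied⇒cellOf (inj₁ c∈E₁) = one _ c∈E₁ , ≡.refl
  occupied⇒cellOf (inj₂ c∈E₂) = let e , e∈ , c∈e = find c∈E₂ in two e e∈ , c∈e

  cellOf⇒index : ∀ a {c} → c cellOf a → ∃[ s ] c cellOf edge s
  cellOf⇒index (one d d∈) {c} c≡d = Any.index d∈ Fin.↑ˡ ∣E₂∣ ,
    subst (λ z → c cellOf edge⊎ z) (≡.sym (Fin.splitAt-↑ˡ ∣E₁∣ (Any.index d∈) ∣E₂∣))
      (≡.trans c≡d (lookup-index d∈))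
  cellOf⇒index (two e e∈) {c} c∈e = ∣E₁∣ Fin.↑ʳ Any.index e∈ ,
    subst (λ z → c cellOf edge⊎ z) (≡.sym (Fin.splitAt-↑ʳ ∣E₁∣ ∣E₂∣ (Any.index e∈)))
      (subst (c isHalfOf_) (lookup-index e∈) c∈e)

  -- Condition (S) separates different edges, and the absence of repetitions in `E₁` and `E₂`
  -- separates different positions of the two lists.
  edge-unique : ∀ {s t c} → c cellOf edge s → c cellOf edge t → s ≡ t
  edge-unique {s} {t} {c} c∈s c∈t = begin
    s                        ≡⟨ Fin.join-splitAt ∣E₁∣ ∣E₂∣ s ⟨
    join (splitAt ∣E₁∣ s)    ≡⟨ cong join (same (splitAt ∣E₁∣ s) (splitAt ∣E₁∣ t) c∈s c∈t) ⟩
    join (splitAt ∣E₁∣ t)    ≡⟨ Fin.join-splitAt ∣E₁∣ ∣E₂∣ t ⟩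
    t                        ∎
    where
    open ≡.≡-Reasoning
    join = Fin.join ∣E₁∣ ∣E₂∣
    same : ∀ x y → c cellOf edge⊎ x → c cellOf edge⊎ y → x ≡ y
    same (inj₁ i) (inj₁ j) c≡ c≡′ = cong inj₁ (decidable-stable (i Fin.≟ j) λ i≢j →
      lookup-AllPairs (_∘ ≡.sym) (BipartiteGraph.unique G₁) i≢j (≡.trans (≡.sym c≡) c≡′))
    same (inj₁ i) (inj₂ j) ≡.refl c∈ = contradiction (∈-lookup {xs = E₁} i) (S₁ (∈-lookup j) c∈)
    same (inj₂ i) (inj₁ j) c∈ ≡.refl = contradiction (∈-lookup {xs = E₁} j) (S₁ (∈-lookup i) c∈)
    same (inj₂ i) (inj₂ j) c∈ c∈′ = cong inj₂ (decidable-stable (i Fin.≟ j) λ i≢j →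
      S₂ (∈-lookup i) (∈-lookup j)
         (lookup-AllPairs (λ {e} {f} → _∘ ≃-sym f e) E₂-unique i≢j) c∈ c∈′)

  -- A substitute for equality of edges, which would be too fine: an `Edge` carries a membership
  -- proof, and 2-edges are compared only up to `≃`.
  shared-cell : ∀ a b {c d} → c cellOf a → c cellOf b → d cellOf b → d cellOf a
  shared-cell (one _ _)  (one _ _)  ≡.refl ≡.refl d≡  = d≡
  shared-cell (one _ c∈) (two _ e∈) ≡.refl c∈e    d∈e = contradiction c∈ (S₁ e∈ c∈e)
  shared-cell (two _ e∈) (one _ c∈) c∈e    ≡.refl d≡  = contradiction c∈ (S₁ e∈ c∈e)
  shared-cell (two e e∈) (two f f∈) c∈e    c∈f    d∈f = isHalfOf-resp-≃ f e (≃-sym e f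
    (decidable-stable (e ≃? f) λ e≄f → S₂ e∈ f∈ e≄f c∈e c∈f)) d∈f

  Disjoint : Edge → Edge → Set
  Disjoint a b = ∀ {c} → c cellOf a → ¬ (c cellOf b)

  two-halves : ∀ {c d} → c ≢ d → ∀ a → c cellOf a → d cellOf a →
    ∃[ e ] e ∈ E₂ × ((half₁ e ≡ c × half₂ e ≡ d) ⊎ (half₁ e ≡ d × half₂ e ≡ c))
  two-halves c≢d (one _ _)  c≡        d≡        = contradiction (≡.trans c≡ (≡.sym d≡)) c≢d
  two-halves c≢d (two e e∈) (inj₁ c≡) (inj₁ d≡) = contradiction (≡.trans c≡ (≡.sym d≡)) c≢d
  two-halves c≢d (two e e∈) (inj₁ c≡) (inj₂ d≡) = e , e∈ , inj₁ (≡.sym c≡ , ≡.sym d≡)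
  two-halves c≢d (two e e∈) (inj₂ c≡) (inj₁ d≡) = e , e∈ , inj₂ (≡.sym d≡ , ≡.sym c≡)
  two-halves c≢d (two e e∈) (inj₂ c≡) (inj₂ d≡) = contradiction (≡.trans c≡ (≡.sym d≡)) c≢d

  -- The squares attached to the edges, and the rigidity of every other decomposition.

  module EdgeForms (F : FormallyRealRing) where

    open FormallyRealRing F
    open DotProduct F
    open BilinearFamilies F
    open GroupProperties +-group using () renaming (∙-cancelʳ to +-cancelʳ)
    open SetoidReasoning setoid

    edgeForms : Fin (∣E₁∣ ℕ.+ ∣E₂∣) → Fin m → Fin n → Carrier
    edgeForms s i j = if does (cellOf? (i , j) (edge s)) then 1# else 0#

    edgeForms-∈ : ∀ {s} c → c cellOf edge s → entry edgeForms c s ≋ 1#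
    edgeForms-∈ {s} c c∈s rewrite dec-true (cellOf? c (edge s)) c∈s = refl

    edgeForms-∉ : ∀ {s} c → ¬ (c cellOf edge s) → entry edgeForms c s ≋ 0#
    edgeForms-∉ {s} c c∉s rewrite dec-false (cellOf? c (edge s)) c∉s = refl

    gram : Cell m n → Cell m n → Carrier
    gram c d = entry edgeForms c · entry edgeForms d

    gram-same : ∀ a {c d} → c cellOf a → d cellOf a → gram c d ≋ 1#
    gram-same a {c} {d} c∈a d∈a with cellOf⇒index a c∈a
    ... | s , c∈s = begin
      gram c d
        ≈⟨ sum-single s (λ t → entry edgeForms c t * entry edgeForms d t) (λ t t≢s →
             trans (*-congʳ (edgeForms-∉ c λ c∈t → t≢s (edge-unique c∈t c∈s))) (zeroˡ _)) ⟩
      entry edgeForms c s * entry edgeForms d s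
        ≈⟨ *-cong (edgeForms-∈ c c∈s) (edgeForms-∈ d (shared-cell (edge s) a c∈s c∈a d∈a)) ⟩
      1# * 1#
        ≈⟨ *-identityˡ 1# ⟩
      1#
        ∎

    gram-disjoint : ∀ a b {c d} → Disjoint a b → c cellOf a → d cellOf b → gram c d ≋ 0#
    gram-disjoint a b {c} {d} a∩b≡∅ c∈a d∈b = sum-zero _ λ s → product≈0 s
      (cellOf? c (edge s))
      where
      product≈0 : ∀ s → Dec (c cellOf edge s) → entry edgeForms c s * entry edgeForms d s ≋ 0#
      product≈0 s (no c∉s)  = trans (*-congʳ (edgeForms-∉ c c∉s)) (zeroˡ _)
      product≈0 s (yes c∈s) = trans (*-congˡ (edgeForms-∉ d λ d∈s →
        a∩b≡∅ (shared-cell a (edge s) c∈a c∈s d∈s) d∈b)) (zeroʳ _)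

    gram-unoccupied : ∀ {c} d → Unoccupied c → gram c d ≋ 0#
    gram-unoccupied {c} d c-free = sum-zero _ λ s →
      trans (*-congʳ (edgeForms-∉ c λ c∈s → c-free (cellOf⇒occupied (edge s) c∈s))) (zeroˡ _)

    -- Any other decomposition into squares has the same Gram matrix on the
    -- cells representing the edges, hence at least as many squares as edges.
    module _ (acyclic : WellFounded (flip Arc)) {r} (f : Fin r → Fin m → Fin n → Carrier)
      (norms : ∀ x y → normSquared f x y ≋ normSquared edgeForms x y)
      where

      private
        v : Cell m n → Fin r → Carrier
        v = entry f

        -- The Gram entries of f already known to coincide with those of the edge forms; a priori
        -- only sums of two entries are known to do so.
        Agree : Cell m n → Cell m n → Set
        Agree c d = v c · v d ≋ gram c d

        agree-sym : ∀ {c d} → Agree c d → Agree d c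
        agree-sym {c} {d} agree =
          trans (·-comm (v d) (v c)) (trans agree (·-comm (entry edgeForms c) (entry edgeForms d)))

        -- Here the rectangle collapses, both diagonals give the same product and the coefficient is
        -- its double. The case c = d yields the norms.
        agree-collinear : ∀ {c d} → Collinear c d → Agree c d
        agree-collinear {i , j} {_ , l} (inj₁ ≡.refl) = double-cancel (begin
          _ ≈⟨ +-congˡ (·-comm (v (i , j)) (v (i , l))) ⟩
          _ ≈⟨ gram-cross f edgeForms norms i j i l ⟩
          _ ≈⟨ +-congˡ (·-comm (entry edgeForms (i , l)) (entry edgeForms (i , j))) ⟩
          _ ∎)
        agree-collinear {i , j} {k , _} (inj₂ ≡.refl) =
          double-cancel (gram-cross f edgeForms norms i j k j)

        -- The coefficient fixes the sum over the two diagonals of a rectangle, so knowledge of one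
        -- diagonal passes to the other.
        agree-opposite : ∀ {i j k l} → Agree (i , l) (k , j) → Agree (i , j) (k , l)
        agree-opposite {i} {j} {k} {l} agree = +-cancelʳ _ _ _
          (trans (gram-cross f edgeForms norms i j k l) (+-congˡ (sym agree)))

        agree-unoccupied : ∀ {c} d → Unoccupied c → Agree c d
        agree-unoccupied {c} d c-free = trans
          (sum-zero _ λ p → trans (*-congʳ (vc≈0 p)) (zeroˡ _)) (sym (gram-unoccupied d c-free))
          where
          vc≈0 : v c ≋ᵛ λ _ → 0#
          vc≈0 = ·-self≈0 (trans (agree-collinear {c} {c} (inj₁ ≡.refl)) (gram-unoccupied c c-free))

        norm≈1 : ∀ a {c} → c cellOf a → v c · v c ≋ 1#
        norm≈1 a {c} c∈a = trans (agree-collinear {c} {c} (inj₁ ≡.refl)) (gram-same a c∈a c∈a)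

        Tight : Edge → Set
        Tight a = ∀ {c d} → c cellOf a → d cellOf a → v c ≋ᵛ v d

        one-tight : ∀ c c∈ → Tight (one c c∈)
        one-tight _ _ ≡.refl ≡.refl p = refl

        agree⇒tight : ∀ {e} e∈ → Agree (half₁ e) (half₂ e) → Tight (two e e∈)
        agree⇒tight {e} e∈ agree = tight
          where
          halves≈ : v (half₁ e) ≋ᵛ v (half₂ e)
          halves≈ = unit-vectors-≈ (norm≈1 (two e e∈) (inj₁ ≡.refl)) (norm≈1 (two e e∈) (inj₂ ≡.refl))
            (trans agree (gram-same (two e e∈) (inj₁ ≡.refl) (inj₂ ≡.refl)))
          tight : Tight (two e e∈)
          tight (inj₁ ≡.refl) (inj₁ ≡.refl) p = refl
          tight (inj₁ ≡.refl) (inj₂ ≡.refl) p = halves≈ p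
          tight (inj₂ ≡.refl) (inj₁ ≡.refl) p = sym (halves≈ p)
          tight (inj₂ ≡.refl) (inj₂ ≡.refl) p = refl

        -- Tightness allows c and d to be replaced by any other cells of a and b. If the edges share
        -- a row or column, collinear cells are chosen. Otherwise W3 supplies an unoccupied opposite
        -- cell, which is a corner of the rectangle spanned by some cell of a and some cell of b.
        tight-pair-agree : ∀ a b → Disjoint a b → Is2Edge a ⊎ Is2Edge b → Tight a → Tight b →
                           ∀ {c d} → c cellOf a → d cellOf b → Agree c d
        tight-pair-agree a b a∩b≡∅ 2-edge a-tight b-tight {c} {d} c∈a d∈b =
          transfer (Any.any? (λ c′ → Any.any? (collinear? c′) (cells b)) (cells a))
          where
          moved : ∀ {c′ d′} → c′ cellOf a → d′ cellOf b → Agree c′ d′ → Agree c d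
          moved {c′} {d′} c′∈a d′∈b agree = begin
            v c · v d      ≈⟨ ·-cong (a-tight c∈a c′∈a) (b-tight d∈b d′∈b) ⟩
            v c′ · v d′    ≈⟨ agree ⟩
            gram c′ d′     ≈⟨ gram-disjoint a b a∩b≡∅ c′∈a d′∈b ⟩
            0#             ≈⟨ gram-disjoint a b a∩b≡∅ c∈a d∈b ⟨
            gram c d       ∎
          transfer : Dec (Any (λ c′ → Any (Collinear c′) (cells b)) (cells a)) → Agree c d
          transfer (yes meet) =
            let c′ , c′∈ , meet′ = find meet
                d′ , d′∈ , col   = find meet′
            in moved (∈cells⇒cellOf a c′∈) (∈cells⇒cellOf b d′∈) (agree-collinear col)
          transfer (no ¬meet) with W3 a b 2-edge
            ( (λ i ((j , ij∈a) , (l , il∈b)) → ¬meet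
                (lose (cellOf⇒∈cells a ij∈a) (lose (cellOf⇒∈cells b il∈b) (inj₁ ≡.refl))))
            , (λ j ((i , ij∈a) , (k , kj∈b)) → ¬meet
                (lose (cellOf⇒∈cells a ij∈a) (lose (cellOf⇒∈cells b kj∈b) (inj₂ ≡.refl)))) )
          ... | _ , inj₁ ((j , ij∈a) , (k , kl∈b)) , free =
            moved ij∈a kl∈b (agree-opposite (agree-unoccupied _ free))
          ... | _ , inj₂ ((l , kl∈b) , (i , ij∈a)) , free =
            moved ij∈a kl∈b (agree-opposite (agree-sym (agree-unoccupied _ free)))

        -- An unoccupied opposite cell settles the other diagonal at once. If both are occupied,
        -- arcs lead from e to the nondegenerate 2-edges on them, which are tight by recursion;
        -- 1-edges and degenerate 2-edges are tight outright. W2′ ensures that the two edges on the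
        -- opposite cells are not both 1-edges, so W3 applies to them.
        tight-nondegenerate : ∀ {e} e∈ → Nondegenerate e → Acc (flip Arc) e → Tight (two e e∈)
        tight-nondegenerate {e} e∈ nondeg (acc rs)
          with occupied? (opposite₁ e) | occupied? (opposite₂ e)
        ... | no free | _       = agree⇒tight e∈ (agree-opposite (agree-unoccupied _ free))
        ... | yes _   | no free =
          agree⇒tight e∈ (agree-opposite (agree-sym (agree-unoccupied _ free)))
        ... | yes o₁  | yes o₂  = agree⇒tight e∈ (agree-opposite
          (tight-pair-agree a b disjoint (2-edge a b o₁∈a o₂∈b)
            (tight-dependent a (inj₁ o₁∈a)) (tight-dependent b (inj₂ o₂∈b)) o₁∈a o₂∈b))
          where
          a    = proj₁ (occupied⇒cellOf o₁)
          b    = proj₁ (occupied⇒cellOf o₂)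
          o₁∈a = proj₂ (occupied⇒cellOf o₁)
          o₂∈b = proj₂ (occupied⇒cellOf o₂)

          arc : ∀ {e′} → e′ ∈ E₂ → Nondegenerate e′ →
                opposite₁ e isHalfOf e′ ⊎ opposite₂ e isHalfOf e′ → Arc e e′
          arc {e′} e′∈ nondeg′ dep = record
            { source        = e∈ , nondeg
            ; target        = e′∈ , nondeg′
            ; e≄e′          = λ e≃e′ → Sum.[ opposite₁∉e ∘ isHalfOf-resp-≃ e′ e (≃-sym e e′ e≃e′)
                                           , opposite₂∉e ∘ isHalfOf-resp-≃ e′ e (≃-sym e e′ e≃e′) ] dep
            ; opp₁-occupied = o₁
            ; opp₂-occupied = o₂
            ; dependent     = dep
            }
            where
            opposite₁∉e : ¬ (opposite₁ e isHalfOf e)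
            opposite₁∉e (inj₁ eq) = proj₂ nondeg (≡.sym (cong proj₂ eq))
            opposite₁∉e (inj₂ eq) = proj₁ nondeg (cong proj₁ eq)
            opposite₂∉e : ¬ (opposite₂ e isHalfOf e)
            opposite₂∉e (inj₁ eq) = proj₁ nondeg (≡.sym (cong proj₁ eq))
            opposite₂∉e (inj₂ eq) = proj₂ nondeg (cong proj₂ eq)

          tight-dependent : ∀ z → opposite₁ e cellOf z ⊎ opposite₂ e cellOf z → Tight z
          tight-dependent (one c c∈)   _   = one-tight c c∈
          tight-dependent (two e′ e′∈) dep with collinear? (half₁ e′) (half₂ e′)
          ... | yes col = agree⇒tight e′∈ (agree-collinear col)
          ... | no ¬col = tight-nondegenerate e′∈ nondeg′ (rs (arc e′∈ nondeg′ dep))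
            where nondeg′ = ¬collinear⇒nondegenerate e′ ¬col

          -- A 2-edge on both opposite cells would be complementary to e, and
          -- the two would form a cycle.
          disjoint : Disjoint a b
          disjoint c∈a c∈b with two-halves (λ eq → proj₁ nondeg (cong proj₁ eq)) a
                                  o₁∈a (shared-cell a b c∈a c∈b o₂∈b)
          ... | e′@(mk2 _ _ _) , e′∈ , inj₁ (≡.refl , ≡.refl) =
            wf⇒asym acyclic (arc e′∈ nondeg′ (inj₁ (inj₁ ≡.refl))) (record
              { source        = e′∈ , nondeg′
              ; target        = e∈ , nondeg
              ; e≄e′          = Arc.e≄e′ (arc e′∈ nondeg′ (inj₁ (inj₁ ≡.refl))) ∘ ≃-sym e′ e
              ; opp₁-occupied = inj₂ (lose e∈ (inj₁ ≡.refl))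
              ; opp₂-occupied = inj₂ (lose e∈ (inj₂ ≡.refl))
              ; dependent     = inj₁ (inj₁ ≡.refl)
              })
            where nondeg′ = proj₁ nondeg , proj₂ nondeg ∘ ≡.sym
          ... | e′@(mk2 _ _ _) , e′∈ , inj₂ (≡.refl , ≡.refl) =
            wf⇒asym acyclic (arc e′∈ nondeg′ (inj₁ (inj₂ ≡.refl))) (record
              { source        = e′∈ , nondeg′
              ; target        = e∈ , nondeg
              ; e≄e′          = Arc.e≄e′ (arc e′∈ nondeg′ (inj₁ (inj₂ ≡.refl))) ∘ ≃-sym e′ e
              ; opp₁-occupied = inj₂ (lose e∈ (inj₂ ≡.refl))
              ; opp₂-occupied = inj₂ (lose e∈ (inj₁ ≡.refl))
              ; dependent     = inj₁ (inj₂ ≡.refl)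
              })
            where nondeg′ = proj₁ nondeg ∘ ≡.sym , proj₂ nondeg

          2-edge : ∀ a b → opposite₁ e cellOf a → opposite₂ e cellOf b → Is2Edge a ⊎ Is2Edge b
          2-edge (two _ _)  _          _      _      = inj₁ is2
          2-edge (one _ _)  (two _ _)  _      _      = inj₂ is2
          2-edge (one _ c∈) (one _ d∈) ≡.refl ≡.refl = contradiction (c∈ , d∈) (W2′ e∈ nondeg)

        tight : ∀ a → Tight a
        tight (one c c∈) = one-tight c c∈
        tight (two e e∈) with collinear? (half₁ e) (half₂ e)
        ... | yes col = agree⇒tight e∈ (agree-collinear col)
        ... | no ¬col = tight-nondegenerate e∈ (¬collinear⇒nondegenerate e ¬col) (acyclic e)

        -- W3 says nothing about two 1-edges, so the other diagonal of their rectangle is used. If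
        -- both its cells are occupied, W1 prevents them from both being 1-edges and W2′ from being
        -- the halves of one 2-edge; what remains is a disjoint pair containing a 2-edge.
        one-pair-agree : ∀ {c d} → c ∈ E₁ → d ∈ E₁ → Agree c d
        one-pair-agree {i , j} {k , l} c∈ d∈ with collinear? (i , j) (k , l)
        ... | yes col = agree-collinear col
        ... | no ¬col with occupied? (i , l) | occupied? (k , j)
        ...   | no free | _       = agree-opposite (agree-unoccupied _ free)
        ...   | yes _   | no free = agree-opposite (agree-sym (agree-unoccupied _ free))
        ...   | yes o₁  | yes o₂  = agree-opposite
          (tight-pair-agree a b disjoint (2-edge a b o₁∈a o₂∈b) (tight a) (tight b) o₁∈a o₂∈b)
          where
          a    = proj₁ (occupied⇒cellOf o₁)
          b    = proj₁ (occupied⇒cellOf o₂)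
          o₁∈a = proj₂ (occupied⇒cellOf o₁)
          o₂∈b = proj₂ (occupied⇒cellOf o₂)

          disjoint : Disjoint a b
          disjoint c∈a c∈b with two-halves (λ eq → ¬col (inj₁ (cong proj₁ eq))) a
                                  o₁∈a (shared-cell a b c∈a c∈b o₂∈b)
          ... | mk2 _ _ _ , e∈ , inj₁ (≡.refl , ≡.refl) =
            W2′ e∈ (¬col ∘ inj₁ , ¬col ∘ inj₂ ∘ ≡.sym) (c∈ , d∈)
          ... | mk2 _ _ _ , e∈ , inj₂ (≡.refl , ≡.refl) =
            W2′ e∈ (¬col ∘ inj₁ ∘ ≡.sym , ¬col ∘ inj₂) (d∈ , c∈)

          2-edge : ∀ a b → (i , l) cellOf a → (k , j) cellOf b → Is2Edge a ⊎ Is2Edge b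
          2-edge (two _ _)   _           _      _      = inj₁ is2
          2-edge (one _ _)   (two _ _)   _      _      = inj₂ is2
          2-edge (one _ il∈) (one _ kj∈) ≡.refl ≡.refl =
            contradiction (c∈ , il∈ , kj∈ , d∈) (W1 (¬col ∘ inj₁) (¬col ∘ inj₂))

        representative : ∀ a → ∃[ c ] c cellOf a
        representative (one c _) = c , ≡.refl
        representative (two e _) = half₁ e , inj₁ ≡.refl

        pair-agree : ∀ a b → Disjoint a b → ∀ {c d} → c cellOf a → d cellOf b → Agree c d
        pair-agree (one _ c∈)   (one _ d∈)   _   ≡.refl ≡.refl = one-pair-agree c∈ d∈
        pair-agree a@(one _ _)  b@(two _ _)  a∩b = tight-pair-agree a b a∩b (inj₂ is2) (tight a) (tight b)
        pair-agree a@(two _ _)  b            a∩b = tight-pair-agree a b a∩b (inj₁ is2) (tight a) (tight b)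

      edges≤squares : ∣E₁∣ ℕ.+ ∣E₂∣ ℕ.≤ r
      edges≤squares = orthonormal⇒≤ (v ∘ cell) (unit , orthogonal)
        where
        cell : Fin (∣E₁∣ ℕ.+ ∣E₂∣) → Cell m n
        cell s = proj₁ (representative (edge s))
        cell∈ : ∀ s → cell s cellOf edge s
        cell∈ s = proj₂ (representative (edge s))
        unit : ∀ s → v (cell s) · v (cell s) ≋ 1#
        unit s = norm≈1 (edge s) (cell∈ s)
        orthogonal : ∀ {s t} → s ≢ t → v (cell s) · v (cell t) ≋ 0#
        orthogonal {s} {t} s≢t = trans
          (pair-agree (edge s) (edge t) disjoint (cell∈ s) (cell∈ t))
          (gram-disjoint (edge s) (edge t) disjoint (cell∈ s) (cell∈ t))
          where
          disjoint : Disjoint (edge s) (edge t)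
          disjoint c∈s c∈t = s≢t (edge-unique c∈s c∈t)

-- Translation between the abstract ring and the concrete forms over ℝ.

module _ where

  open FormallyRealRing ℝ-formallyReal using (_*_; refl; sym; trans; *-cong)
  open DotProduct ℝ-formallyReal using (sum; sum-cong-≋)
  open BilinearFamilies
    using (eval; normSquared; symmetrizedGram; symmetrizedGram-symˡ; symmetrizedGram-symᵇ;
           symmetrizedForm; symmetrizedForm-squares)
  open BiquadraticForm using (⟦_⟧)

  -- The ring operations are _+ᴿ_ and _*ᴿ_ by definition, but comparing whole
  -- expressions would unfold the Cauchy moduli, so the two readings are
  -- identified one operation at a time.
  ∑-cong : ∀ {n} (t u : Fin n → ℝ) → (∀ i → t i ≈ u i) → sum t ≈ ∑ u
  ∑-cong t u t≈u = sum-cong-≋ {x = t} {y = u} t≈u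

  *ᴿ-cong : ∀ a a′ b b′ → a ≈ a′ → b ≈ b′ → a * b ≈ a′ *ᴿ b′
  *ᴿ-cong a a′ b b′ = *-cong {a} {a′} {b} {b′}

  *ᴿ-congʳ : ∀ a a′ b → a ≈ a′ → a * b ≈ a′ *ᴿ b
  *ᴿ-congʳ a a′ b a≈a′ = *ᴿ-cong a a′ b b a≈a′ (refl {b})

  eval≈evalBilinear : ∀ {m n} (b : BilinearForm m n) x y →
                      eval ℝ-formallyReal b x y ≈ evalBilinear b x y
  eval≈evalBilinear b x y = ∑-cong _ _ λ i → ∑-cong _ _ λ j → monomial (b i j) (x i) (y j)
    where
    monomial : ∀ a x y → a * x * y ≈ a *ᴿ x *ᴿ y
    monomial a x y = *ᴿ-congʳ (a * x) (a *ᴿ x) y (*ᴿ-congʳ a a x (refl {a}))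

  normSquared≈ : ∀ {r m n} (f : Fin r → BilinearForm m n) x y →
    normSquared ℝ-formallyReal f x y ≈
    ∑ (λ p → evalBilinear (f p) x y *ᴿ evalBilinear (f p) x y)
  normSquared≈ f x y = ∑-cong _ _ λ p →
    *ᴿ-cong (eval ℝ-formallyReal (f p) x y) (evalBilinear (f p) x y)
            (eval ℝ-formallyReal (f p) x y) (evalBilinear (f p) x y)
            (eval≈evalBilinear (f p) x y) (eval≈evalBilinear (f p) x y)

  sumOfSquares : ∀ {r m n} → (Fin r → BilinearForm m n) → BiquadraticForm m n
  sumOfSquares f = record
    { coeff = symmetrizedGram ℝ-formallyReal f
    ; symˡ  = symmetrizedGram-symˡ ℝ-formallyReal f
    ; symᵇ  = symmetrizedGram-symᵇ ℝ-formallyReal f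
    }

  symmetrizedForm≈ : ∀ {r m n} (f : Fin r → BilinearForm m n) x y →
    symmetrizedForm ℝ-formallyReal f x y ≈ ⟦ sumOfSquares f ⟧ x y
  symmetrizedForm≈ f x y =
    ∑-cong _ _ λ i → ∑-cong _ _ λ k → ∑-cong _ _ λ j → ∑-cong _ _ λ l →
      monomial (symmetrizedGram ℝ-formallyReal f i j k l) (x i) (x k) (y j) (y l)
    where
    monomial : ∀ a x x′ y y′ → a * x * x′ * y * y′ ≈ a *ᴿ x *ᴿ x′ *ᴿ y *ᴿ y′
    monomial a x x′ y y′ =
      *ᴿ-congʳ (a * x * x′ * y) (a *ᴿ x *ᴿ x′ *ᴿ y) y′
        (*ᴿ-congʳ (a * x * x′) (a *ᴿ x *ᴿ x′) y
          (*ᴿ-congʳ (a * x) (a *ᴿ x) x′ (*ᴿ-congʳ a a x (refl {a}))))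

  sumOfSquares-normSquared : ∀ {r m n} (f : Fin r → BilinearForm m n) x y →
    ⟦ sumOfSquares f ⟧ x y ≈ normSquared ℝ-formallyReal f x y
  sumOfSquares-normSquared f x y = trans
    {⟦ sumOfSquares f ⟧ x y} {symmetrizedForm ℝ-formallyReal f x y}
    {normSquared ℝ-formallyReal f x y}
    (sym {symmetrizedForm ℝ-formallyReal f x y} {⟦ sumOfSquares f ⟧ x y} (symmetrizedForm≈ f x y))
    (symmetrizedForm-squares ℝ-formallyReal f x y)

  sumOfSquares-isSumOfSquares : ∀ {r m n} (f : Fin r → BilinearForm m n) →
                                IsSumOfSquares (sumOfSquares f) r
  sumOfSquares-isSumOfSquares f = f , λ x y → trans
    {⟦ sumOfSquares f ⟧ x y} {normSquared ℝ-formallyReal f x y}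
    {∑ (λ p → evalBilinear (f p) x y *ᴿ evalBilinear (f p) x y)}
    (sumOfSquares-normSquared f x y) (normSquared≈ f x y)

  same-normSquared : ∀ {r s m n} (f : Fin r → BilinearForm m n) (g : Fin s → BilinearForm m n) →
    (∀ x y → ⟦ sumOfSquares g ⟧ x y ≈ ∑ (λ p → evalBilinear (f p) x y *ᴿ evalBilinear (f p) x y)) →
    ∀ x y → normSquared ℝ-formallyReal f x y ≈ normSquared ℝ-formallyReal g x y
  same-normSquared f g P≈∑f² x y = trans {normSquared ℝ-formallyReal f x y}
    {∑ (λ p → evalBilinear (f p) x y *ᴿ evalBilinear (f p) x y)}
    {normSquared ℝ-formallyReal g x y}
    (normSquared≈ f x y)
    (trans {∑ (λ p → evalBilinear (f p) x y *ᴿ evalBilinear (f p) x y)}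
      {⟦ sumOfSquares g ⟧ x y} {normSquared ℝ-formallyReal g x y}
      (sym {⟦ sumOfSquares g ⟧ x y} {∑ (λ p → evalBilinear (f p) x y *ᴿ evalBilinear (f p) x y)}
        (P≈∑f² x y))
      (sumOfSquares-normSquared g x y))

-- The rank is determined exactly: the edge forms are a decomposition with this many squares, and
-- rigidity excludes shorter ones. This makes the count an actual SOS rank, as the witness for BSR
-- requires.
edgeCount∈SOSRanks : ∀ {m n} (G : AugmentedGraph m n) → let open AugmentedGraph G in
  WeakAdmissible G → WellFounded (flip Arc) → SOSRanks m n (∣E₁∣ ℕ.+ ∣E₂∣)
edgeCount∈SOSRanks G admissible acyclic =
  sumOfSquares (edgeForms admissible ℝ-formallyReal) ,
  (_ , sumOfSquares-isSumOfSquares (edgeForms admissible ℝ-formallyReal)) , record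
  { attained = sumOfSquares-isSumOfSquares (edgeForms admissible ℝ-formallyReal)
  ; bound    = λ { (f , P≈∑f²) → edges≤squares admissible ℝ-formallyReal acyclic f
      (same-normSquared f (edgeForms admissible ℝ-formallyReal) P≈∑f²) }
  }
  where open WeaklyAdmissible.EdgeForms using (edgeForms; edges≤squares)

-- The upper bound for the Zarankiewicz number.

orderedPairs : ∀ n → List (Fin n × Fin n)
orderedPairs n = filter (λ (j , l) → j Fin.<? l) (cartesianProduct (allFin n) (allFin n))

-- A cell (i , l) of G is charged to its row i if it is the leftmost cell of
-- that row, and otherwise to a pair j < l with (i , j) also in G; two rows
-- sharing such a pair would form a C₄.
C₄-free⇒size≤ : ∀ {m n} (G : BipartiteGraph m n) → C₄-free G →
                BipartiteGraph.∣edges∣ G ℕ.≤ m ℕ.+ length (orderedPairs n)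
C₄-free⇒size≤ {m} {n} G C₄-free-G = Fin.injective⇒≤ {f = λ s → charge (lookup edges s)}
  λ {s} {t} eq → decidable-stable (s Fin.≟ t) λ s≢t →
    lookup-AllPairs (_∘ ≡.sym) unique s≢t
      (charge-injective (lookup edges s) (lookup edges t) (∈-lookup s) (∈-lookup t) eq)
  where
  open BipartiteGraph G

  Left : Fin m → Fin n → Fin n → Set
  Left i l j = (j Fin.< l) × (i , j) ∈ edges

  left? : ∀ i l → Dec (∃[ j ] Left i l j)
  left? i l = Fin.any? λ j → (j Fin.<? l) ×-dec Any.any? ((i , j) ≟ᶜ_) edges

  ordered∈ : ∀ {j l} → j Fin.< l → (j , l) ∈ orderedPairs n
  ordered∈ j<l = ∈-filter⁺ (λ (j , l) → j Fin.<? l)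
    (∈-cartesianProduct⁺ (∈-allFin _) (∈-allFin _)) j<l

  -- The decision is an argument so that the injectivity proof can match on the decisions for two
  -- cells independently.
  charge⊎ : ∀ i l → Dec (∃[ j ] Left i l j) → Fin m ⊎ Fin (length (orderedPairs n))
  charge⊎ i l (yes (j , j<l , _)) = inj₂ (Any.index (ordered∈ j<l))
  charge⊎ i l (no _)              = inj₁ i

  charge : Cell m n → Fin (m ℕ.+ length (orderedPairs n))
  charge (i , l) = Fin.join m _ (charge⊎ i l (left? i l))

  charge⊎-injective : ∀ {i l i′ l′} (d : Dec (∃[ j ] Left i l j)) (d′ : Dec (∃[ j ] Left i′ l′ j)) →
    (i , l) ∈ edges → (i′ , l′) ∈ edges → charge⊎ i l d ≡ charge⊎ i′ l′ d′ → (i , l) ≡ (i′ , l′)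
  charge⊎-injective {i} {l} {i′} {l′} (yes (j , j<l , ij∈)) (yes (j′ , j′<l′ , i′j′∈)) il∈ i′l′∈ eq
    with ≡.trans (lookup-index (ordered∈ j<l))
           (≡.trans (cong (lookup (orderedPairs n)) (inj₂-injective eq))
                    (≡.sym (lookup-index (ordered∈ j′<l′))))
  ... | ≡.refl = cong (_, l) (decidable-stable (i Fin.≟ i′) λ i≢i′ →
    C₄-free-G i≢i′ (Fin.<⇒≢ j<l) (ij∈ , il∈ , i′j′∈ , i′l′∈))
  charge⊎-injective {i} {l} {_} {l′} (no ¬left) (no ¬left′) il∈ il′∈ ≡.refl with Fin.<-cmp l l′
  ... | tri< l<l′ _ _ = contradiction (l , l<l′ , il∈) ¬left′
  ... | tri≈ _ l≡l′ _ = cong (i ,_) l≡l′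
  ... | tri> _ _ l′<l = contradiction (l′ , l′<l , il′∈) ¬left

  charge-injective : ∀ c d → c ∈ edges → d ∈ edges → charge c ≡ charge d → c ≡ d
  charge-injective (i , l) (i′ , l′) c∈ d∈ eq = charge⊎-injective (left? i l) (left? i′ l′) c∈ d∈
    (≡.trans (≡.sym (Fin.splitAt-join m _ (charge⊎ i l (left? i l))))
      (≡.trans (cong (Fin.splitAt m) eq) (Fin.splitAt-join m _ (charge⊎ i′ l′ (left? i′ l′)))))

-- NoPath is stronger than W2: it excludes all paths of length two in the
-- dependency graph.
module Check {m n} (G : AugmentedGraph m n) where

  open AugmentedGraph G
  open TwoEdge
  open Edges G

  -- W3 tested on pairs of cells: a collinear pair shows that the edges are not vertex-disjoint, and
  -- any other admissible pair exhibits an unoccupied opposite cell.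
  Separated : List (Cell m n) → List (Cell m n) → Set
  Separated cs ds = Any (λ c → Any (λ d →
    Collinear c d ⊎ Unoccupied (proj₁ c , proj₂ d) ⊎ Unoccupied (proj₁ d , proj₂ c)) ds) cs

  -- W1 with the memberships interleaved among the quantifiers, so that its decision abandons a
  -- branch at the first absent cell.
  ColumnsDetermineRow : Set
  ColumnsDetermineRow = ∀ i j → (i , j) ∈ E₁ → ∀ l → (i , l) ∈ E₁ →
    ∀ k → (k , j) ∈ E₁ → (k , l) ∈ E₁ → i ≡ k ⊎ j ≡ l

  HalvesAvoid1Edges : Set
  HalvesAvoid1Edges = All (λ e → half₁ e ∉ E₁ × half₂ e ∉ E₁) E₂

  HalvesDisjoint : Set
  HalvesDisjoint = All (λ e → All (λ f →
    e ≃ f ⊎ ¬ half₁ e isHalfOf f × ¬ half₂ e isHalfOf f) E₂) E₂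

  OppositesAvoid1Edges : Set
  OppositesAvoid1Edges = All (λ e → ¬ (opposite₁ e ∈ E₁ × opposite₂ e ∈ E₁)) E₂

  NoPath : Set
  NoPath = All (λ e → All (λ f →
    Occupied (opposite₁ e) → Occupied (opposite₂ e) →
    opposite₁ e isHalfOf f ⊎ opposite₂ e isHalfOf f →
    ¬ (Occupied (opposite₁ f) × Occupied (opposite₂ f))) E₂) E₂

  SeparatedFrom1Edges : Set
  SeparatedFrom1Edges = All (λ e → All (λ d → Separated (halves e) (d ∷ [])) E₁) E₂

  SeparatedFrom2Edges : Set
  SeparatedFrom2Edges = All (λ e → All (λ f → Separated (halves e) (halves f)) E₂) E₂

  -- The membership test is a parameter, so that a concrete graph can supply a direct criterion,
  -- such as incidence of a vertex with a pair, in place of a search through `E₁`.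
  module Decide (_∈E₁? : ∀ c → Dec (c ∈ E₁)) where

    occupied? : ∀ c → Dec (Occupied c)
    occupied? c = (c ∈E₁?) ⊎-dec Any.any? (isHalfOf? c) E₂

    separated? : ∀ cs ds → Dec (Separated cs ds)
    separated? cs ds = Any.any? (λ c → Any.any? (λ d →
      collinear? c d ⊎-dec (¬? (occupied? (proj₁ c , proj₂ d))
                     ⊎-dec ¬? (occupied? (proj₁ d , proj₂ c)))) ds) cs

    columnsDetermineRow? : Dec ColumnsDetermineRow
    columnsDetermineRow? =
      Fin.all? λ i → Fin.all? λ j → ((i , j) ∈E₁?) →-dec
      (Fin.all? λ l → ((i , l) ∈E₁?) →-dec
      (Fin.all? λ k → ((k , j) ∈E₁?) →-dec
      (((k , l) ∈E₁?) →-dec ((i Fin.≟ k) ⊎-dec (j Fin.≟ l)))))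

    halvesAvoid1Edges? : Dec HalvesAvoid1Edges
    halvesAvoid1Edges? = All.all? (λ e → ¬? (half₁ e ∈E₁?) ×-dec ¬? (half₂ e ∈E₁?)) E₂

    halvesDisjoint? : Dec HalvesDisjoint
    halvesDisjoint? = All.all? (λ e → All.all? (λ f →
      (e ≃? f) ⊎-dec (¬? (isHalfOf? (half₁ e) f) ×-dec ¬? (isHalfOf? (half₂ e) f))) E₂) E₂

    oppositesAvoid1Edges? : Dec OppositesAvoid1Edges
    oppositesAvoid1Edges? =
      All.all? (λ e → ¬? ((opposite₁ e ∈E₁?) ×-dec (opposite₂ e ∈E₁?))) E₂

    noPath? : Dec NoPath
    noPath? = All.all? (λ e → All.all? (λ f →
      occupied? (opposite₁ e) →-dec (occupied? (opposite₂ e) →-dec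
      ((isHalfOf? (opposite₁ e) f ⊎-dec isHalfOf? (opposite₂ e) f) →-dec
      ¬? (occupied? (opposite₁ f) ×-dec occupied? (opposite₂ f))))) E₂) E₂

    separatedFrom1Edges? : Dec SeparatedFrom1Edges
    separatedFrom1Edges? =
      All.all? (λ e → All.all? (λ d → separated? (halves e) (d ∷ [])) E₁) E₂

    separatedFrom2Edges? : Dec SeparatedFrom2Edges
    separatedFrom2Edges? =
      All.all? (λ e → All.all? (λ f → separated? (halves e) (halves f)) E₂) E₂

  no-consecutive-arcs : NoPath → ∀ {e f g} → Arc e f → ¬ Arc f g
  no-consecutive-arcs no-path e→f f→g =
    All.lookup (All.lookup no-path (proj₁ (Arc.source e→f))) (proj₁ (Arc.target e→f))
      (Arc.opp₁-occupied e→f) (Arc.opp₂-occupied e→f) (Arc.dependent e→f)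
      (Arc.opp₁-occupied f→g , Arc.opp₂-occupied f→g)

  -- Every target of an arc is a sink, so accessibility is reached after two steps.
  acyclic : NoPath → WellFounded (flip Arc)
  acyclic no-path e = acc λ e→f → acc λ f→g →
    contradiction f→g (no-consecutive-arcs no-path e→f)

  -- Every closed walk contains two consecutive arcs; a loop is followed by itself.
  no-directed-cycle : NoPath → ∀ {e es} → ¬ DirectedCycle e es
  no-directed-cycle np {es = []}        (_ , e→e ∷ _)       = no-consecutive-arcs np e→e e→e
  no-directed-cycle np {es = _ ∷ []}    (_ , e→f ∷ f→e ∷ _) = no-consecutive-arcs np e→f f→e
  no-directed-cycle np {es = _ ∷ _ ∷ _} (_ , e→f ∷ f→g ∷ _) = no-consecutive-arcs np e→f f→g

  separated⇒unoccupied : ∀ a b → Separated (cells a) (cells b) → VertexDisjoint a b →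
                         ∃[ c ] OppositeCell a b c × Unoccupied c
  separated⇒unoccupied a b separated (rows-disjoint , columns-disjoint)
    with find separated
  ... | (i , j) , c∈ , rest with find rest | ∈cells⇒cellOf a c∈
  ...   | (k , l) , d∈ , cases | c∈a with ∈cells⇒cellOf b d∈ | cases
  ...     | d∈b | inj₁ (inj₁ ≡.refl) = contradiction ((j , c∈a) , (l , d∈b)) (rows-disjoint i)
  ...     | d∈b | inj₁ (inj₂ ≡.refl) = contradiction ((i , c∈a) , (k , d∈b)) (columns-disjoint j)
  ...     | d∈b | inj₂ (inj₁ free)   = (i , l) , inj₁ ((j , c∈a) , (k , d∈b)) , free
  ...     | d∈b | inj₂ (inj₂ free)   = (k , j) , inj₂ ((l , d∈b) , (i , c∈a)) , free

  weakAdmissible : ColumnsDetermineRow → HalvesAvoid1Edges → HalvesDisjoint →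
    OppositesAvoid1Edges → NoPath → SeparatedFrom1Edges → SeparatedFrom2Edges → WeakAdmissible G
  weakAdmissible rows avoid disjoint opposites no-path separated₁ separated₂ = record
    { S₁  = λ { e∈ (inj₁ ≡.refl) → proj₁ (All.lookup avoid e∈)
              ; e∈ (inj₂ ≡.refl) → proj₂ (All.lookup avoid e∈) }
    ; S₂  = λ {_} {e} {f} e∈ f∈ → halves-disjoint e f (All.lookup (All.lookup disjoint e∈) f∈)
    ; W1  = λ {i} {k} {j} {l} i≢k j≢l (ij , il , kj , kl) →
              Sum.[ i≢k , j≢l ] (rows i j ij l il k kj kl)
    ; W2  = λ cycle → contradiction cycle (no-directed-cycle no-path)
    ; W2′ = λ e∈ _ → All.lookup opposites e∈
    ; W3  = w3
    }
    where
    halves-disjoint : ∀ {c} e f → e ≃ f ⊎ ¬ half₁ e isHalfOf f × ¬ half₂ e isHalfOf f →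
                      e ≄ f → c isHalfOf e → ¬ (c isHalfOf f)
    halves-disjoint _ _ (inj₁ e≃f)      e≄f _             = contradiction e≃f e≄f
    halves-disjoint _ _ (inj₂ (h₁∉ , _)) _  (inj₁ ≡.refl) = h₁∉
    halves-disjoint _ _ (inj₂ (_ , h₂∉)) _  (inj₂ ≡.refl) = h₂∉

    w3 : ∀ a b → Is2Edge a ⊎ Is2Edge b → VertexDisjoint a b →
         ∃[ c ] OppositeCell a b c × Unoccupied c
    w3 a@(two e e∈) b@(one d d∈) _ = separated⇒unoccupied a b
      (All.lookup (All.lookup separated₁ e∈) d∈)
    w3 a@(two e e∈) b@(two f f∈) _ = separated⇒unoccupied a b
      (All.lookup (All.lookup separated₂ e∈) f∈)
    w3 a@(one c c∈) b@(two f f∈) _ (rows , columns) =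
      let d , opposite , free = separated⇒unoccupied b a
            (All.lookup (All.lookup separated₁ f∈) c∈)
            ((λ i (p , q) → rows i (q , p)) , (λ j (p , q) → columns j (q , p)))
      in d , Sum.swap opposite , free
    w3 (one _ _) (one _ _) (inj₁ ())
    w3 (one _ _) (one _ _) (inj₂ ())

-- The incidence graph of K₆ with its fourteen 2-edges.

module K₆ where

  _∈E₁? : ∀ c → Dec (c ∈ AugmentedGraph.E₁ K₆-augmented)
  (e , v) ∈E₁? = map′
    (∈-filter⁺ (λ (e , v) → v Subset.∈? pair e)
               (∈-cartesianProduct⁺ (∈-allFin e) (∈-allFin v)))
    (proj₂ ∘ ∈-filter⁻ (λ (e , v) → v Subset.∈? pair e)
                       {xs = cartesianProduct (allFin 15) (allFin 6)})
    (v Subset.∈? pair e)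

  open AugmentedGraph K₆-augmented
  open Check K₆-augmented
  open Decide _∈E₁?

  noPath : NoPath
  noPath = from-yes noPath?

  K₆-weakAdmissible : WeakAdmissible K₆-augmented
  K₆-weakAdmissible = weakAdmissible
    (from-yes columnsDetermineRow?) (from-yes halvesAvoid1Edges?) (from-yes halvesDisjoint?)
    (from-yes oppositesAvoid1Edges?) noPath
    (from-yes separatedFrom1Edges?) (from-yes separatedFrom2Edges?)

  K₆-acyclic : WellFounded (flip Arc)
  K₆-acyclic = acyclic noPath

  zarankiewicz-15-6 : IsZarankiewicz 15 6 ∣E₁∣
  zarankiewicz-15-6 = record
    { attained = K₆-incidence , WeakAdmissible.W1 K₆-weakAdmissible , ≡.refl
    -- The general bound evaluates to 15 rows plus 15 pairs of columns, which is exactly `∣E₁∣`.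
    ; bound    = λ { (H , H-C₄-free , size) →
        subst (ℕ._≤ ∣E₁∣) size (C₄-free⇒size≤ H H-C₄-free) }
    }

member⇒MaxAtLeast : ∀ {P : ℕ → Set} {k} → P k → MaxAtLeast P k
member⇒MaxAtLeast {k = k} Pk = record
  { maximum≥ = λ max → IsMaximum.bound max Pk
  ; witness  = k , Pk , ℕ.≤-refl
  }

open import Data.Nat using (_+_)
open K₆ using (K₆-weakAdmissible; K₆-acyclic; zarankiewicz-15-6)
open AugmentedGraph K₆-augmented using (∣E₁∣; ∣E₂∣)

theorem17 : WeakAdmissible K₆-augmented
    × (∣E₁∣ ≡ 30 × ∣E₂∣ ≡ 14 × ∣E₁∣ + ∣E₂∣ ≡ 44)
    × (z-wL[ 15 , 6 ]≥ (∣E₁∣ + ∣E₂∣))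
    × (BSR[ 15 , 6 ]≥ 44)
theorem17 =
    K₆-weakAdmissible
  , (≡.refl , ≡.refl , ≡.refl)
  , member⇒MaxAtLeast (K₆-augmented , K₆-weakAdmissible , zarankiewicz-15-6 , ≡.refl)
  , subst (BSR[ 15 , 6 ]≥_) {x = ∣E₁∣ + ∣E₂∣} ≡.refl
      (member⇒MaxAtLeast (edgeCount∈SOSRanks K₆-augmented K₆-weakAdmissible K₆-acyclic))
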